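{- Let $\pi_1$, $\pi_2$ be two disjoint generators of $\mathcal{Q}^{+}(5,q)$, let $\mathcal{T}$ be a set of points of $\mathcal{Q}^{+}(5,q)$ disjoint from $\pi_{1}\cup\pi_{2}$, and let $\bm{c}'$ be the vector obtained from the characteristic vector of $\mathcal{T}$ by removing the entries corresponding to points of $\pi_{1}\cup\pi_{2}$. Let $\bm{A}'$ be the matrix obtained from the collinearity matrix $\bm{A}$ of $\mathcal{Q}^{+}(5,q)$ by deleting the rows and columns corresponding to points of $\pi_1\cup\pi_2$, and $\bm{j}'$ the all-ones vector of the corresponding length. Then $\mathcal{T}$ is an $x$-tight set of $\mathcal{Q}^{+}(5,q)$ if and only if \[ \left(\bm{c}' - \tfrac{x}{q^{2}-1}\bm{j}'\right)\bm{A}' = (q^{2}-1)\left(\bm{c}' - \tfrac{x}{q^{2}-1}\bm{j}'\right). \]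
   Context: $\mathcal{Q}^{+}(5,q)$ is the hyperbolic quadric in $\mathrm{PG}(5,q)$; generators are the planes on it. The collinearity matrix $\bm{A}$ is indexed by points of the quadric, with $\bm{A}_{\bm{p},\bm{r}}=1$ if $\bm{p}\neq\bm{r}$ lie on a common line of the quadric and $0$ otherwise. For a point $\bm{p}$, $\bm{p}^{\perp}$ denotes the set of points of the quadric collinear with $\bm{p}$, including $\bm{p}$. A point set $\mathcal{T}$ is an $x$-tight set if $|\bm{p}^{\perp}\cap\mathcal{T}|=x(q+1)+q^2\bm{c}_{\mathcal{T}}(\bm{p})$ for every point $\bm{p}$ of the quadric, where $\bm{c}_{\mathcal{T}}$ is the characteristic function of $\mathcal{T}$. -}

module Defs where

open import Level using (0ℓ)
open import Data.Nat as ℕ using (ℕ; zero; suc)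
open import Data.Fin using (Fin)
open import Data.Bool using (Bool; true; false; _∧_; _∨_; not; if_then_else_; T?)
open import Data.List using (length; List; []; _∷_; map; concatMap; filter; foldr; all; allFin)
open import Data.Vec using (Vec; []; _∷_; zipWith)
import Data.Vec as Vec
open import Data.Vec.Properties using (≡-dec)
open import Data.Product using (Σ; _×_; ∃; _,_)
open import Data.Integer using (+_)
open import Data.Rational as ℚ using (ℚ; _/_)
open import Relation.Nullary using (¬_; does)
open import Relation.Binary.PropositionalEquality using (_≡_; _≢_)
open import Relation.Binary.Definitions using (DecidableEquality)
open import Algebra.Structures using (IsCommutativeRing)
open import Function.Bundles using (_↔_; Inverse)

record FiniteField (q : ℕ) : Set₁ where
  infixl 6 _+_
  infixl 7 _*_
  field
    Carrier  : Set
    _+_ _*_  : Carrier → Carrier → Carrier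
    -_       : Carrier → Carrier
    0# 1#    : Carrier
    isCommutativeRing : IsCommutativeRing _≡_ _+_ _*_ -_ 0# 1#
    0≢1      : 0# ≢ 1#
    inverse  : ∀ x → x ≢ 0# → Σ Carrier (λ y → x * y ≡ 1#)
    _≟_      : DecidableEquality Carrier
    enum     : Fin q ↔ Carrier

module _ {q : ℕ} (F : FiniteField q) where
  open FiniteField F

  Vec6 : Set
  Vec6 = Vec Carrier 6

  elems : List Carrier
  elems = map (Inverse.to enum) (allFin q)

  isZero : Carrier → Bool
  isZero a = does (a ≟ 0#)

  allVecs : (n : ℕ) → List (Vec Carrier n)
  allVecs zero    = [] ∷ []
  allVecs (suc n) = concatMap (λ a → map (a ∷_) (allVecs n)) elems

  isNormalised : {n : ℕ} → Vec Carrier n → Bool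
  isNormalised []       = false
  isNormalised (a ∷ as) = if isZero a then isNormalised as else does (a ≟ 1#)

  Qform : Vec6 → Carrier
  Qform (a ∷ b ∷ c ∷ d ∷ e ∷ f ∷ []) = a * b + c * d + e * f

  -- points of Q+(5,q): normalised representatives of singular projective points
  isPoint : Vec6 → Bool
  isPoint v = isNormalised v ∧ isZero (Qform v)

  IsPoint : Vec6 → Set
  IsPoint v = isPoint v ≡ true

  points : List Vec6
  points = filter (λ v → T? (isPoint v)) (allVecs 6)

  _·_ : Carrier → Vec6 → Vec6
  a · v = Vec.map (a *_) v

  _⊕_ : Vec6 → Vec6 → Vec6
  _⊕_ = zipWith _+_

  eqV : Vec6 → Vec6 → Bool
  eqV u v = does (≡-dec _≟_ u v)

  -- p ≠ r lie on a common line of the quadric: every point λp+μr of the line pr is singular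
  collinear : Vec6 → Vec6 → Bool
  collinear p r = not (eqV p r) ∧
    all (λ l → all (λ m → isZero (Qform ((l · p) ⊕ (m · r)))) elems) elems

  PointSet : Set
  PointSet = Vec6 → Bool

  IsGenerator : PointSet → Set
  IsGenerator π = Σ Vec6 λ u → Σ Vec6 λ v → Σ Vec6 λ w →
      (∀ a b c → ((a · u) ⊕ (b · v)) ⊕ (c · w) ≡ Vec.replicate 6 0# →
         (a ≡ 0#) × (b ≡ 0#) × (c ≡ 0#))
    × (∀ a b c → Qform (((a · u) ⊕ (b · v)) ⊕ (c · w)) ≡ 0#)
    × (∀ p → IsPoint p →
         (π p ≡ true → Σ Carrier λ a → Σ Carrier λ b → Σ Carrier λ c →
                          p ≡ ((a · u) ⊕ (b · v)) ⊕ (c · w))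
       × (Σ Carrier (λ a → Σ Carrier λ b → Σ Carrier λ c →
                          p ≡ ((a · u) ⊕ (b · v)) ⊕ (c · w)) → π p ≡ true))

  DisjointSets : PointSet → PointSet → Set
  DisjointSets S U = ∀ p → IsPoint p → ¬ (S p ≡ true × U p ≡ true)

  ⟦_⟧ : ℕ → ℚ
  ⟦ n ⟧ = + n / 1

  χ : Bool → ℚ
  χ true  = ℚ.1ℚ
  χ false = ℚ.0ℚ

  sumℚ : List Vec6 → (Vec6 → ℚ) → ℚ
  sumℚ xs f = foldr (λ v acc → f v ℚ.+ acc) ℚ.0ℚ xs

  perpCount : PointSet → Vec6 → ℕ
  perpCount T p = length (filter (λ r → T? ((eqV p r ∨ collinear p r) ∧ T r)) points)

  IsTight : PointSet → ℚ → Set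
  IsTight T x = ∀ p → IsPoint p →
    ⟦ perpCount T p ⟧ ≡ x ℚ.* ⟦ q ℕ.+ 1 ⟧ ℚ.+ ⟦ q ℕ.* q ⟧ ℚ.* χ (T p)

  -- the scalar x/(q²-1); q ≥ 2 for any field, the q < 2 branch is unreachable junk
  divQ²-1 : ℚ → ℚ
  divQ²-1 x = x ℚ.* inv q
    where
      inv : ℕ → ℚ
      inv (suc (suc n)) = + 1 / ((suc (suc n)) ℕ.* (suc (suc n)) ℕ.∸ 1)
      inv _ = ℚ.0ℚ

  -- points outside π₁ ∪ π₂ (index set of A', c', j')
  outside : PointSet → PointSet → List Vec6
  outside π₁ π₂ = filter (λ p → T? (not (π₁ p ∨ π₂ p))) points

  -- (c' - x/(q²-1) j') A' = (q²-1)(c' - x/(q²-1) j'), checked entrywise over columns r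
  MatrixEq : PointSet → PointSet → PointSet → ℚ → Set
  MatrixEq π₁ π₂ T x = ∀ r → IsPoint r → π₁ r ≡ false → π₂ r ≡ false →
    sumℚ (outside π₁ π₂) (λ p → (χ (T p) ℚ.- divQ²-1 x) ℚ.* χ (collinear p r))
      ≡ ⟦ q ℕ.* q ℕ.∸ 1 ⟧ ℚ.* (χ (T r) ℚ.- divQ²-1 x)

{-# OPTIONS --safe #-}
-- The defect of T at a vector v measures the failure of the tightness equation there. Off π₁ ∪ π₂ the
-- matrix equation says exactly that the defect vanishes, since a point off a generator is collinear with
-- q + 1 of its points and with q(q+1)² points of the quadric in all. On the other hand the sum of the
-- defect over a totally singular plane is the same for all planes, because t^⊥ meets the plane in a line
-- unless t lies on it. For a point r of π₁, identify π₂ with the dual of π₁: the graph of a ↦ a × r is a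
-- totally singular plane that meets π₁ only in r and misses π₂. Hence the defect is constant on π₁, and
-- comparing with the sum over π₁ itself the constant is zero.
module Submission where

open import Level using (0ℓ)
open import Defs hiding (_⊕_; _·_; ⟦_⟧)
open import Data.Nat as ℕ using (ℕ; zero; suc)
import Data.Nat.Properties as ℕₚ
open import Data.Bool using (Bool; true; false; _∧_; _∨_; not; T?)
open import Data.Bool.Properties using (¬-not)
open import Data.Fin using (Fin; zero; suc)
import Data.Integer as ℤ
import Data.Integer.Properties as ℤₚ
open import Data.Rational
  using (ℚ; 0ℚ; 1ℚ; _+_; _*_; _-_; -_; _≤_; _/_; 1/_; ≢-nonZero; toℚᵘ)
import Data.Rational.Properties as ℚₚ
open import Data.Rational.Solver using (module +-*-Solver)
import Data.Rational.Unnormalised as ℚᵘ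
import Data.Rational.Unnormalised.Properties as ℚᵘₚ
open import Data.List using (List; []; _∷_; map; concatMap; filter; all; allFin; length; _++_)
open import Data.List.Properties using (length-tabulate)
open import Data.List.Membership.Propositional using (_∈_)
open import Data.List.Membership.Propositional.Properties using (∈-map⁺; ∈-allFin)
open import Data.List.Relation.Unary.Any using (here; there)
open import Data.List.Relation.Unary.All as All using (All; []; _∷_)
open import Data.List.Relation.Unary.Unique.Propositional using (Unique; []; _∷_)
import Data.List.Relation.Unary.Unique.Propositional.Properties as Uniqueₚ
open import Data.Vec using (Vec; []; _∷_; zipWith; replicate)
import Data.Vec as Vec
open import Data.Vec.Properties using (≡-dec; ∷-injective; ∷-injectiveˡ)
open import Data.Product using (∃; _×_; _,_; proj₁; proj₂)
open import Data.Sum using (_⊎_; inj₁; inj₂)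
open import Data.Empty using (⊥-elim)
open import Relation.Nullary using (¬_; Dec; yes; no; does; ¬?)
open import Relation.Nullary.Decidable using (decidable-stable)
open import Relation.Binary.PropositionalEquality
open import Relation.Binary.Definitions using (DecidableEquality)
open import Function using (_∘_; Inverse; _↔_; _⇔_; mk⇔)
open import Algebra.Bundles using (CommutativeRing)
import Algebra.Solver.Ring.NaturalCoefficients.Default as NaturalSolver
open +-*-Solver using (Polynomial; solve; _:=_; con; _:+_; _:*_; _:-_)
open ≡-Reasoning

-- The obstacle is the converse: the matrix equation has no column for a point of π₁ ∪ π₂, yet
-- tightness must be shown there too, so the missing values have to come from planes that meet π₁ ∪
-- π₂ in as little as possible. The totally singular planes missing π₂ are the graphs of alternating
-- maps from π₁ to its dual, and in dimension three an alternating map has the form a ↦ a × r, with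
-- kernel the line of r when r ≠ 0; this is where the cross product comes from. The sum over such a
-- graph involves a single unknown value, and only the equality of plane sums is used, never their
-- common value. All counts run over vectors instead of projective points, because translations and
-- linear maps act on vectors; a point then stands for q - 1 vectors, and the zero vector
-- contributes the same term to every plane sum. Dimension arguments are replaced by counting: an
-- injective self-map of a finite set is onto, and a subset with as many elements as the whole is
-- the whole.

-- Rational arithmetic and indicator functions.

ℕ→ℚ : ℕ → ℚ
ℕ→ℚ n = ℤ.+ n / 1

private
  unnormalise-/1 : ∀ n → toℚᵘ (ℕ→ℚ n) ℚᵘ.≃ ℚᵘ.mkℚᵘ (ℤ.+ n) 0
  unnormalise-/1 n = ℚₚ.toℚᵘ-fromℚᵘ (ℚᵘ.mkℚᵘ (ℤ.+ n) 0)

ℕ→ℚ-+ : ∀ m n → ℕ→ℚ (m ℕ.+ n) ≡ ℕ→ℚ m + ℕ→ℚ n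
ℕ→ℚ-+ m n = ℚₚ.toℚᵘ-injective (ℚᵘₚ.≃-trans (unnormalise-/1 (m ℕ.+ n)) (ℚᵘₚ.≃-sym
  (ℚᵘₚ.≃-trans (ℚₚ.toℚᵘ-homo-+ (ℕ→ℚ m) (ℕ→ℚ n))
  (ℚᵘₚ.≃-trans (ℚᵘₚ.+-cong (unnormalise-/1 m) (unnormalise-/1 n))
  (ℚᵘ.*≡* (cong (ℤ._* ℤ.+ 1) (cong₂ ℤ._+_ (ℤₚ.*-identityʳ (ℤ.+ m)) (ℤₚ.*-identityʳ (ℤ.+ n)))))))))

ℕ→ℚ-* : ∀ m n → ℕ→ℚ (m ℕ.* n) ≡ ℕ→ℚ m * ℕ→ℚ n
ℕ→ℚ-* zero n = sym (ℚₚ.*-zeroˡ (ℕ→ℚ n))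
ℕ→ℚ-* (suc m) n = begin
  ℕ→ℚ (n ℕ.+ m ℕ.* n)         ≡⟨ ℕ→ℚ-+ n (m ℕ.* n) ⟩
  ℕ→ℚ n + ℕ→ℚ (m ℕ.* n)       ≡⟨ cong (ℕ→ℚ n +_) (ℕ→ℚ-* m n) ⟩
  ℕ→ℚ n + ℕ→ℚ m * ℕ→ℚ n       ≡⟨ solve 2 (λ a b → b :+ a :* b := (con 1ℚ :+ a) :* b) refl (ℕ→ℚ m) (ℕ→ℚ n) ⟩
  (1ℚ + ℕ→ℚ m) * ℕ→ℚ n        ≡⟨ cong (_* ℕ→ℚ n) (sym (ℕ→ℚ-+ 1 m)) ⟩
  ℕ→ℚ (suc m) * ℕ→ℚ n         ∎

ℕ→ℚ-injective : ∀ {m n} → ℕ→ℚ m ≡ ℕ→ℚ n → m ≡ n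
ℕ→ℚ-injective {m} {n} eq with ℚᵘₚ.≃-trans (ℚᵘₚ.≃-sym (unnormalise-/1 m))
                                (ℚᵘₚ.≃-trans (ℚᵘₚ.≃-reflexive (cong toℚᵘ eq)) (unnormalise-/1 n))
... | ℚᵘ.*≡* e = ℤₚ.+-injective (trans (sym (ℤₚ.*-identityʳ (ℤ.+ m))) (trans e (ℤₚ.*-identityʳ (ℤ.+ n))))

*-cancelˡ : ∀ c {a b} → c ≢ 0ℚ → c * a ≡ c * b → a ≡ b
*-cancelˡ c {a} {b} c≢0 eq = begin
  a                ≡⟨ sym (undo a) ⟩
  1/c * (c * a)    ≡⟨ cong (1/c *_) eq ⟩
  1/c * (c * b)    ≡⟨ undo b ⟩
  b                ∎
  where
  instance _ = ≢-nonZero c≢0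
  1/c = 1/ c
  undo : ∀ z → 1/c * (c * z) ≡ z
  undo z = trans (sym (ℚₚ.*-assoc 1/c c z)) (trans (cong (_* z) (ℚₚ.*-inverseˡ c)) (ℚₚ.*-identityˡ z))

𝟙 : Bool → ℚ
𝟙 true  = 1ℚ
𝟙 false = 0ℚ

𝟙-∧ : ∀ a b → 𝟙 (a ∧ b) ≡ 𝟙 a * 𝟙 b
𝟙-∧ true  b = sym (ℚₚ.*-identityˡ (𝟙 b))
𝟙-∧ false b = sym (ℚₚ.*-zeroˡ (𝟙 b))

𝟙-guard : ∀ b {x y} → (b ≡ true → x ≡ y) → 𝟙 b * x ≡ 𝟙 b * y
𝟙-guard true  h = cong (1ℚ *_) (h refl)
𝟙-guard false {x} {y} h = trans (ℚₚ.*-zeroˡ x) (sym (ℚₚ.*-zeroˡ y))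

𝟙-⇔ : ∀ {P Q : Set} (p : Dec P) (q : Dec Q) → (P → Q) → (Q → P) → 𝟙 (does p) ≡ 𝟙 (does q)
𝟙-⇔ (yes _)  (yes _)  _ _ = refl
𝟙-⇔ (no _)   (no _)   _ _ = refl
𝟙-⇔ (yes p)  (no ¬q)  f _ = ⊥-elim (¬q (f p))
𝟙-⇔ (no ¬p)  (yes q)  _ g = ⊥-elim (¬p (g q))

𝟙-yes : ∀ {P : Set} (p : Dec P) → P → 𝟙 (does p) ≡ 1ℚ
𝟙-yes (yes _) _ = refl
𝟙-yes (no ¬p) p = ⊥-elim (¬p p)

𝟙-no : ∀ {P : Set} (p : Dec P) → ¬ P → 𝟙 (does p) ≡ 0ℚ
𝟙-no (no _)  _  = refl
𝟙-no (yes p) ¬p = ⊥-elim (¬p p)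

𝟙-≤ : ∀ {P Q : Set} (p : Dec P) (q : Dec Q) → (P → Q) → 𝟙 (does p) ≤ 𝟙 (does q)
𝟙-≤ (yes p) (yes q) _ = ℚₚ.≤-refl
𝟙-≤ (no _)  (no _)  _ = ℚₚ.≤-refl
𝟙-≤ (no _)  (yes _) _ = ℚₚ.nonNegative⁻¹ 1ℚ
𝟙-≤ (yes p) (no ¬q) f = ⊥-elim (¬q (f p))

𝟙≡1⇒ : ∀ {P : Set} (p : Dec P) → 𝟙 (does p) ≡ 1ℚ → P
𝟙≡1⇒ (yes p) _ = p

does-true : ∀ {P : Set} (p : Dec P) → does p ≡ true → P
does-true (yes p) _ = p

true-does : ∀ {P : Set} (p : Dec P) → P → does p ≡ true
true-does (yes _) _ = refl
true-does (no ¬p) p = ⊥-elim (¬p p)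

-- Finite sums over lists

sum : {A : Set} → List A → (A → ℚ) → ℚ
sum []       f = 0ℚ
sum (x ∷ xs) f = f x + sum xs f

module _ {A : Set} where

  sum-cong : ∀ xs {f g : A → ℚ} → (∀ a → f a ≡ g a) → sum xs f ≡ sum xs g
  sum-cong []       h = refl
  sum-cong (x ∷ xs) h = cong₂ _+_ (h x) (sum-cong xs h)

  sum-0 : ∀ (xs : List A) → sum xs (λ _ → 0ℚ) ≡ 0ℚ
  sum-0 []       = refl
  sum-0 (x ∷ xs) = trans (ℚₚ.+-identityˡ _) (sum-0 xs)

  sum-+ : ∀ xs (f g : A → ℚ) → sum xs (λ a → f a + g a) ≡ sum xs f + sum xs g
  sum-+ []       f g = refl
  sum-+ (x ∷ xs) f g = begin
    f x + g x + sum xs (λ a → f a + g a)    ≡⟨ cong (f x + g x +_) (sum-+ xs f g) ⟩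
    (f x + g x) + (sum xs f + sum xs g)
      ≡⟨ solve 4 (λ a b c d → (a :+ b) :+ (c :+ d) := (a :+ c) :+ (b :+ d)) refl (f x) (g x) (sum xs f) (sum xs g) ⟩
    (f x + sum xs f) + (g x + sum xs g)       ∎

  sum-* : ∀ xs c (f : A → ℚ) → sum xs (λ a → c * f a) ≡ c * sum xs f
  sum-* []       c f = sym (ℚₚ.*-zeroʳ c)
  sum-* (x ∷ xs) c f = trans (cong (c * f x +_) (sum-* xs c f)) (sym (ℚₚ.*-distribˡ-+ c (f x) (sum xs f)))

  sum-*ʳ : ∀ xs c (f : A → ℚ) → sum xs (λ a → f a * c) ≡ sum xs f * c
  sum-*ʳ xs c f = trans (sum-cong xs (λ a → ℚₚ.*-comm (f a) c)) (trans (sum-* xs c f) (ℚₚ.*-comm c _))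

  sum-- : ∀ xs (f g : A → ℚ) → sum xs (λ a → f a - g a) ≡ sum xs f - sum xs g
  sum-- []       f g = refl
  sum-- (x ∷ xs) f g = begin
    f x - g x + sum xs (λ a → f a - g a)    ≡⟨ cong (f x - g x +_) (sum-- xs f g) ⟩
    (f x - g x) + (sum xs f - sum xs g)
      ≡⟨ solve 4 (λ a b c d → (a :- b) :+ (c :- d) := (a :+ c) :- (b :+ d)) refl (f x) (g x) (sum xs f) (sum xs g) ⟩
    (f x + sum xs f) - (g x + sum xs g)       ∎

  sum-const : ∀ xs c → sum xs (λ (_ : A) → c) ≡ c * sum xs (λ _ → 1ℚ)
  sum-const xs c = trans (sum-cong xs (λ _ → sym (ℚₚ.*-identityʳ c))) (sum-* xs c (λ _ → 1ℚ))

  sum-length : ∀ (xs : List A) → sum xs (λ _ → 1ℚ) ≡ ℕ→ℚ (length xs)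
  sum-length []       = refl
  sum-length (x ∷ xs) = trans (cong (1ℚ +_) (sum-length xs)) (sym (ℕ→ℚ-+ 1 (length xs)))

  sum-filter : ∀ (b : A → Bool) xs (f : A → ℚ) →
    sum (filter (λ a → T? (b a)) xs) f ≡ sum xs (λ a → 𝟙 (b a) * f a)
  sum-filter b []       f = refl
  sum-filter b (x ∷ xs) f with b x
  ... | true  = cong₂ _+_ (sym (ℚₚ.*-identityˡ (f x))) (sum-filter b xs f)
  ... | false = trans (sum-filter b xs f) (sym (trans (cong (_+ _) (ℚₚ.*-zeroˡ (f x))) (ℚₚ.+-identityˡ _)))

  sum-++ : ∀ xs ys (f : A → ℚ) → sum (xs ++ ys) f ≡ sum xs f + sum ys f
  sum-++ []       ys f = sym (ℚₚ.+-identityˡ _)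
  sum-++ (x ∷ xs) ys f = trans (cong (f x +_) (sum-++ xs ys f)) (sym (ℚₚ.+-assoc (f x) _ _))

  sum-map : ∀ {B : Set} (g : B → A) ys (f : A → ℚ) → sum (map g ys) f ≡ sum ys (f ∘ g)
  sum-map g []       f = refl
  sum-map g (y ∷ ys) f = cong (f (g y) +_) (sum-map g ys f)

  sum-concatMap : ∀ {B : Set} (g : B → List A) ys (f : A → ℚ) →
    sum (concatMap g ys) f ≡ sum ys (λ y → sum (g y) f)
  sum-concatMap g []       f = refl
  sum-concatMap g (y ∷ ys) f = trans (sum-++ (g y) (concatMap g ys) f) (cong (sum (g y) f +_) (sum-concatMap g ys f))

  sum-mono : ∀ xs {f g : A → ℚ} → (∀ a → f a ≤ g a) → sum xs f ≤ sum xs g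
  sum-mono []       h = ℚₚ.≤-refl
  sum-mono (x ∷ xs) h = ℚₚ.+-mono-≤ (h x) (sum-mono xs h)

sum-swap : ∀ {A B : Set} (xs : List A) (ys : List B) (f : A → B → ℚ) →
  sum xs (λ a → sum ys (f a)) ≡ sum ys (λ b → sum xs (λ a → f a b))
sum-swap []       ys f = sym (sum-0 ys)
sum-swap (x ∷ xs) ys f = trans (cong (sum ys (f x) +_) (sum-swap xs ys f)) (sym (sum-+ ys _ _))

-- Finite types: sums, search, change of variables, pigeonhole.

-- `sum-≟` packs completeness and absence of duplicates into one equation: every element is counted
-- exactly once. This is the form in which sums use it.
record Enumeration (A : Set) : Set where
  field
    _≟_   : DecidableEquality A
    list  : List A
    sum-≟ : ∀ a → sum list (λ b → 𝟙 (does (a ≟ b))) ≡ 1ℚ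

  δ : A → A → ℚ
  δ a b = 𝟙 (does (a ≟ b))

  ∑ : (A → ℚ) → ℚ
  ∑ = sum list

  card : ℚ
  card = ∑ (λ _ → 1ℚ)

  δ-subst : ∀ a b (f : A → ℚ) → δ a b * f b ≡ δ a b * f a
  δ-subst a b f with a ≟ b
  ... | yes refl = refl
  ... | no _     = trans (ℚₚ.*-zeroˡ (f b)) (sym (ℚₚ.*-zeroˡ (f a)))

  ∑-δ : ∀ a (f : A → ℚ) → ∑ (λ b → δ a b * f b) ≡ f a
  ∑-δ a f = begin
    ∑ (λ b → δ a b * f b)   ≡⟨ sum-cong list (λ b → δ-subst a b f) ⟩
    ∑ (λ b → δ a b * f a)   ≡⟨ sum-*ʳ list (f a) (δ a) ⟩
    ∑ (δ a) * f a           ≡⟨ cong (_* f a) (sum-≟ a) ⟩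
    1ℚ * f a                ≡⟨ ℚₚ.*-identityˡ (f a) ⟩
    f a                     ∎

  -- The exceptional argument `a` is always the zero scalar or the zero vector in what follows.
  ∑-constant-off : ∀ a (f : A → ℚ) S → (∀ b → b ≢ a → f b ≡ S) → ∑ f ≡ f a + (card - 1ℚ) * S
  ∑-constant-off a f S f≡S = begin
    ∑ f                                               ≡⟨ sum-cong list pointwise ⟩
    ∑ (λ b → δ a b * f b + (1ℚ - δ a b) * S)          ≡⟨ sum-+ list _ _ ⟩
    ∑ (λ b → δ a b * f b) + ∑ (λ b → (1ℚ - δ a b) * S)
      ≡⟨ cong₂ _+_ (∑-δ a f) (trans (sum-*ʳ list S _)
           (cong (_* S) (trans (sum-- list (λ _ → 1ℚ) (δ a)) (cong (λ z → card - z) (sum-≟ a))))) ⟩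
    f a + (card - 1ℚ) * S                             ∎
    where
    pointwise : ∀ b → f b ≡ δ a b * f b + (1ℚ - δ a b) * S
    pointwise b with a ≟ b
    ... | yes _  = solve 2 (λ x s → x := con 1ℚ :* x :+ (con 1ℚ :- con 1ℚ) :* s) refl (f b) S
    ... | no a≢b = trans (f≡S b (a≢b ∘ sym)) (solve 2 (λ x s → s := con 0ℚ :* x :+ (con 1ℚ :- con 0ℚ) :* s) refl (f b) S)

  search : ∀ {P : A → Set} → (∀ a → Dec (P a)) → Dec (∃ P)
  search {P} P? with go list
    where
    -- Failure is recorded as a count: an element satisfying `P` occurs zero times in the part
    -- searched, which for the whole list contradicts `sum-≟`.
    go : ∀ xs → ∃ P ⊎ (∀ a → P a → sum xs (δ a) ≡ 0ℚ)
    go [] = inj₂ (λ _ _ → refl)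
    go (x ∷ xs) with P? x | go xs
    ... | yes p | _      = inj₁ (x , p)
    ... | no _  | inj₁ e = inj₁ e
    ... | no ¬p | inj₂ h = inj₂ λ a Pa → cong₂ _+_ (𝟙-no (a ≟ x) (λ { refl → ¬p Pa })) (h a Pa)
  ... | inj₁ e = yes e
  ... | inj₂ h = no λ { (a , Pa) → 1≢0 (trans (sym (sum-≟ a)) (h a Pa)) }
    where
    1≢0 : 1ℚ ≢ 0ℚ
    1≢0 ()

  -- The difference `g - f` is nonnegative with sum zero, and each single value is at most that sum.
  -- For indicators: a subset with as many elements as the set containing it is all of it.
  ≤∧∑≡⇒≡ : ∀ (f g : A → ℚ) → (∀ a → f a ≤ g a) → ∑ f ≡ ∑ g → ∀ a → f a ≡ g a
  ≤∧∑≡⇒≡ f g f≤g ∑≡ a = ℚₚ.≤-antisym (f≤g a) g≤f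
    where
    d : A → ℚ
    d b = g b - f b
    0≤d : ∀ b → 0ℚ ≤ d b
    0≤d b = subst (_≤ d b) (ℚₚ.+-inverseʳ (f b)) (ℚₚ.+-monoˡ-≤ (- f b) (f≤g b))
    ∑d≡0 : ∑ d ≡ 0ℚ
    ∑d≡0 = trans (sum-- list g f) (trans (cong (_- ∑ f) (sym ∑≡)) (ℚₚ.+-inverseʳ (∑ f)))
    δ≤1 : ∀ b → δ a b * d b ≤ d b
    δ≤1 b with a ≟ b
    ... | yes _ = ℚₚ.≤-reflexive (ℚₚ.*-identityˡ (d b))
    ... | no _  = subst (_≤ d b) (sym (ℚₚ.*-zeroˡ (d b))) (0≤d b)
    d≤0 : d a ≤ 0ℚ
    d≤0 = subst₂ _≤_ (∑-δ a d) ∑d≡0 (sum-mono list δ≤1)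
    g≤f : g a ≤ f a
    g≤f = subst₂ _≤_ (solve 2 (λ g f → (g :- f) :+ f := g) refl (g a) (f a)) (ℚₚ.+-identityˡ (f a))
                     (ℚₚ.+-monoˡ-≤ (f a) d≤0)

module _ {A B : Set} (EA : Enumeration A) (EB : Enumeration B) where
  private
    module A = Enumeration EA
    module B = Enumeration EB

  module Injection (i : A → B) (inj : ∀ {a a′} → i a ≡ i a′ → a ≡ a′) where

    image? : ∀ b → Dec (∃ λ a → i a ≡ b)
    image? b = A.search (λ a → i a B.≟ b)

    private
      ∑-fibre : ∀ b → A.∑ (λ a → B.δ (i a) b) ≡ 𝟙 (does (image? b))
      ∑-fibre b with image? b
      ... | yes (a , refl) = trans (sum-cong A.list (λ a′ → 𝟙-⇔ (i a′ B.≟ i a) (a A.≟ a′) (sym ∘ inj) (cong i ∘ sym)))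
                                   (A.sum-≟ a)
      ... | no ¬e = trans (sum-cong A.list (λ a → 𝟙-no (i a B.≟ b) (λ e → ¬e (a , e)))) (sum-0 A.list)

    -- Writing `f (i a)` as a sum against `δ (i a)` and exchanging the sums leaves at each `b` the
    -- size of its fibre, which injectivity makes 0 or 1.
    ∑-image : ∀ (f : B → ℚ) → A.∑ (f ∘ i) ≡ B.∑ (λ b → 𝟙 (does (image? b)) * f b)
    ∑-image f = begin
      A.∑ (λ a → f (i a))                             ≡⟨ sum-cong A.list (λ a → sym (B.∑-δ (i a) f)) ⟩
      A.∑ (λ a → B.∑ (λ b → B.δ (i a) b * f b))       ≡⟨ sum-swap A.list B.list _ ⟩
      B.∑ (λ b → A.∑ (λ a → B.δ (i a) b * f b))       ≡⟨ sum-cong B.list (λ b → sum-*ʳ A.list (f b) _) ⟩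
      B.∑ (λ b → A.∑ (λ a → B.δ (i a) b) * f b)       ≡⟨ sum-cong B.list (λ b → cong (_* f b) (∑-fibre b)) ⟩
      B.∑ (λ b → 𝟙 (does (image? b)) * f b)           ∎

    ∑-supported : ∀ (f : B → ℚ) → (∀ b → ¬ (∃ λ a → i a ≡ b) → f b ≡ 0ℚ) → B.∑ f ≡ A.∑ (f ∘ i)
    ∑-supported f f≡0 = trans (sum-cong B.list pointwise) (sym (∑-image f))
      where
      pointwise : ∀ b → f b ≡ 𝟙 (does (image? b)) * f b
      pointwise b with image? b
      ... | yes _ = sym (ℚₚ.*-identityˡ (f b))
      ... | no ¬e = trans (f≡0 b ¬e) (sym (ℚₚ.*-zeroˡ (f b)))

    ∑-bijection : (∀ b → ∃ λ a → i a ≡ b) → ∀ (f : B → ℚ) → B.∑ f ≡ A.∑ (f ∘ i)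
    ∑-bijection surj f = ∑-supported f (λ b ¬e → ⊥-elim (¬e (surj b)))

module _ {A : Set} (EA : Enumeration A) where
  open Enumeration EA

  -- Pigeonhole: by `∑-image` the indicator of the image has the same sum as the constant 1 that
  -- bounds it. It takes the place of a rank argument for linear maps.
  injective⇒surjective : (i : A → A) → (∀ {a a′} → i a ≡ i a′ → a ≡ a′) → ∀ b → ∃ λ a → i a ≡ b
  injective⇒surjective i inj b = 𝟙≡1⇒ (image? b)
    (≤∧∑≡⇒≡ (λ b → 𝟙 (does (image? b))) (λ _ → 1ℚ) ≤1 total b)
    where
    open Injection EA EA i inj
    ≤1 : ∀ b → 𝟙 (does (image? b)) ≤ 1ℚ
    ≤1 b = 𝟙-≤ (image? b) (yes b) (λ _ → b)
    total : ∑ (λ b → 𝟙 (does (image? b))) ≡ ∑ (λ _ → 1ℚ)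
    total = trans (sum-cong list (λ b → sym (ℚₚ.*-identityʳ (𝟙 (does (image? b)))))) (sym (∑-image (λ _ → 1ℚ)))

sum-δ-unique : ∀ {A : Set} (_≟_ : DecidableEquality A) {xs} → Unique xs → ∀ {a} → a ∈ xs →
  sum xs (λ b → 𝟙 (does (a ≟ b))) ≡ 1ℚ
sum-δ-unique {A} _≟_ {x ∷ xs} (x∉ ∷ u) {a} (here refl) =
  cong₂ _+_ (𝟙-yes (a ≟ x) refl) (absent x∉)
  where
  absent : ∀ {ys} → All (a ≢_) ys → sum ys (λ b → 𝟙 (does (a ≟ b))) ≡ 0ℚ
  absent []               = refl
  absent {y ∷ _} (a≢ ∷ h) = cong₂ _+_ (𝟙-no (a ≟ y) a≢) (absent h)
sum-δ-unique _≟_ {x ∷ xs} (x∉ ∷ u) {a} (there a∈) =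
  trans (cong₂ _+_ (𝟙-no (a ≟ x) (λ { refl → All.lookup x∉ a∈ refl })) (sum-δ-unique _≟_ u a∈)) (ℚₚ.+-identityˡ 1ℚ)

-- The scalar x/(q² - 1), exhaustive Boolean checks, and the sums of the statement.

*-/-inverse : ∀ k .{{_ : ℕ.NonZero k}} → ℕ→ℚ k * (ℤ.+ 1 / k) ≡ 1ℚ
*-/-inverse (suc k) = ℚₚ.toℚᵘ-injective (ℚᵘₚ.≃-trans (ℚₚ.toℚᵘ-homo-* (ℕ→ℚ (suc k)) (ℤ.+ 1 / suc k))
  (ℚᵘₚ.≃-trans (ℚᵘₚ.*-cong (ℚₚ.toℚᵘ-fromℚᵘ (ℚᵘ.mkℚᵘ (ℤ.+ suc k) 0)) (ℚₚ.toℚᵘ-fromℚᵘ (ℚᵘ.mkℚᵘ (ℤ.+ 1) k)))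
  (ℚᵘ.*≡* (trans (ℤₚ.*-identityʳ _) (trans (ℤₚ.*-identityʳ (ℤ.+ suc k)) (sym (trans (ℤₚ.*-identityˡ _) (cong (λ n → ℤ.+ suc n) (ℕₚ.+-identityʳ k)))))))))

-- The bound on `q` selects the branch in which `divQ²-1` really divides; below 2 it multiplies by
-- the default value 0.
divQ²-1-spec : ∀ q (F : FiniteField q) → 2 ℕ.≤ q → ∀ x → ℕ→ℚ (q ℕ.* q ℕ.∸ 1) * divQ²-1 F x ≡ x
divQ²-1-spec (suc (suc n)) F _ x = begin
  ℕ→ℚ k * (x * (ℤ.+ 1 / k))     ≡⟨ solve 3 (λ k x i → k :* (x :* i) := x :* (k :* i)) refl (ℕ→ℚ k) x (ℤ.+ 1 / k) ⟩
  x * (ℕ→ℚ k * (ℤ.+ 1 / k))     ≡⟨ cong (x *_) (*-/-inverse k) ⟩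
  x * 1ℚ                        ≡⟨ ℚₚ.*-identityʳ x ⟩
  x                             ∎
  where
  k : ℕ
  k = suc (suc n) ℕ.* suc (suc n) ℕ.∸ 1
divQ²-1-spec (suc zero) F (ℕ.s≤s ()) x

all-true : ∀ {A : Set} (f : A → Bool) xs → (∀ a → f a ≡ true) → all f xs ≡ true
all-true f []       h = refl
all-true f (x ∷ xs) h rewrite h x = all-true f xs h

all-true⁻ : ∀ {A : Set} (f : A → Bool) {xs a} → a ∈ xs → all f xs ≡ true → f a ≡ true
all-true⁻ f {x ∷ _} a∈          h with f x in fx
all-true⁻ f {x ∷ _} (here refl) h | true = fx
all-true⁻ f {x ∷ _} (there a∈)  h | true = all-true⁻ f a∈ h

true-⇔⇒≡ : ∀ {a b} → (a ≡ true → b ≡ true) → (b ≡ true → a ≡ true) → a ≡ b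
true-⇔⇒≡ {true}  {b}     f _ = sym (f refl)
true-⇔⇒≡ {false} {false} _ _ = refl
true-⇔⇒≡ {false} {true}  _ g with g refl
... | ()

χ≡𝟙 : ∀ {q} (F : FiniteField q) b → χ F b ≡ 𝟙 b
χ≡𝟙 F true  = refl
χ≡𝟙 F false = refl

sumℚ≡sum : ∀ {q} (F : FiniteField q) xs f → sumℚ F xs f ≡ sum xs f
sumℚ≡sum F []       f = refl
sumℚ≡sum F (v ∷ xs) f = cong (f v +_) (sumℚ≡sum F xs f)

-- Arithmetic of the field and of vectors over it.

module HyperbolicQuadric {q : ℕ} (F : FiniteField q) where

  open FiniteField F renaming
    ( Carrier to K; _+_ to infixl 6 _+ᶠ_; _*_ to infixl 7 _*ᶠ_; -_ to -ᶠ_; 0# to 0ᶠ; 1# to 1ᶠ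
    ; _≟_ to _≟ᶠ_)

  ring : CommutativeRing 0ℓ 0ℓ
  ring = record { isCommutativeRing = isCommutativeRing }
  open CommutativeRing ring using ()
    renaming ( +-identityˡ to +ᶠ-identityˡ; +-identityʳ to +ᶠ-identityʳ; *-identityˡ to *ᶠ-identityˡ
             ; -‿inverseʳ to -ᶠ-inverseʳ; zeroˡ to *ᶠ-zeroˡ; zeroʳ to *ᶠ-zeroʳ; *-comm to *ᶠ-comm; *-assoc to *ᶠ-assoc)

  module 𝔽 = NaturalSolver (CommutativeRing.commutativeSemiring ring)

  *ᶠ-nonzero : ∀ {a b} → a ≢ 0ᶠ → b ≢ 0ᶠ → a *ᶠ b ≢ 0ᶠ
  *ᶠ-nonzero {a} {b} a≢0 b≢0 ab≡0 with inverse a a≢0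
  ... | a⁻¹ , aa⁻¹≡1 = b≢0 (begin
    b                  ≡⟨ sym (*ᶠ-identityˡ b) ⟩
    1ᶠ *ᶠ b            ≡⟨ cong (_*ᶠ b) (sym aa⁻¹≡1) ⟩
    (a *ᶠ a⁻¹) *ᶠ b    ≡⟨ 𝔽.solve 3 (λ x y z → x 𝔽.:* y 𝔽.:* z 𝔽.:= y 𝔽.:* (x 𝔽.:* z)) refl a a⁻¹ b ⟩
    a⁻¹ *ᶠ (a *ᶠ b)    ≡⟨ cong (a⁻¹ *ᶠ_) ab≡0 ⟩
    a⁻¹ *ᶠ 0ᶠ          ≡⟨ *ᶠ-zeroʳ a⁻¹ ⟩
    0ᶠ                 ∎)

  infixl 6 _⊕_
  infixl 7 _•_
  _⊕_ : ∀ {n} → Vec K n → Vec K n → Vec K n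
  _⊕_ = zipWith _+ᶠ_

  _•_ : ∀ {n} → K → Vec K n → Vec K n
  a • v = Vec.map (a *ᶠ_) v

  𝟎 : ∀ {n} → Vec K n
  𝟎 {n} = replicate n 0ᶠ

  -- Two scalars with sum zero instead of a scalar and its negative, so that adding then subtracting
  -- and subtracting then adding are both instances.
  ⊕-•-cancel : ∀ {n} {a b} → a +ᶠ b ≡ 0ᶠ → (y r : Vec K n) → y ⊕ a • r ⊕ b • r ≡ y
  ⊕-•-cancel _ [] [] = refl
  ⊕-•-cancel {a = a} {b} a+b≡0 (y ∷ ys) (r ∷ rs) = cong₂ _∷_ head (⊕-•-cancel a+b≡0 ys rs)
    where
    head : y +ᶠ a *ᶠ r +ᶠ b *ᶠ r ≡ y
    head = begin
      y +ᶠ a *ᶠ r +ᶠ b *ᶠ r   ≡⟨ 𝔽.solve 4 (λ y a b r → y 𝔽.:+ a 𝔽.:* r 𝔽.:+ b 𝔽.:* r 𝔽.:= y 𝔽.:+ (a 𝔽.:+ b) 𝔽.:* r) refl y a b r ⟩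
      y +ᶠ (a +ᶠ b) *ᶠ r      ≡⟨ cong (λ z → y +ᶠ z *ᶠ r) a+b≡0 ⟩
      y +ᶠ 0ᶠ *ᶠ r            ≡⟨ 𝔽.solve 2 (λ y r → y 𝔽.:+ 𝔽.con 0 𝔽.:* r 𝔽.:= y) refl y r ⟩
      y                       ∎

  •-assoc : ∀ {n} a b (v : Vec K n) → a • (b • v) ≡ (a *ᶠ b) • v
  •-assoc a b [] = refl
  •-assoc a b (x ∷ v) = cong₂ _∷_ (sym (*ᶠ-assoc a b x)) (•-assoc a b v)

  •-identity : ∀ {n} (v : Vec K n) → 1ᶠ • v ≡ v
  •-identity [] = refl
  •-identity (x ∷ v) = cong₂ _∷_ (*ᶠ-identityˡ x) (•-identity v)

  •-zeroˡ : ∀ {n} (v : Vec K n) → 0ᶠ • v ≡ 𝟎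
  •-zeroˡ [] = refl
  •-zeroˡ (x ∷ v) = cong₂ _∷_ (*ᶠ-zeroˡ x) (•-zeroˡ v)

  •-zeroʳ : ∀ {n} a → a • 𝟎 {n} ≡ 𝟎
  •-zeroʳ {zero} a = refl
  •-zeroʳ {suc n} a = cong₂ _∷_ (*ᶠ-zeroʳ a) (•-zeroʳ a)

  ⊕-identityˡ : ∀ {n} (v : Vec K n) → 𝟎 ⊕ v ≡ v
  ⊕-identityˡ [] = refl
  ⊕-identityˡ (x ∷ v) = cong₂ _∷_ (+ᶠ-identityˡ x) (⊕-identityˡ v)

  ⊕-comm : ∀ {n} (u v : Vec K n) → u ⊕ v ≡ v ⊕ u
  ⊕-comm [] [] = refl
  ⊕-comm (x ∷ u) (y ∷ v) = cong₂ _∷_ (CommutativeRing.+-comm ring x y) (⊕-comm u v)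

  ⊕-identityʳ : ∀ {n} (v : Vec K n) → v ⊕ 𝟎 ≡ v
  ⊕-identityʳ v = trans (⊕-comm v 𝟎) (⊕-identityˡ v)

  ⊕-interchange : ∀ {n} c (u v u′ v′ : Vec K n) → (u ⊕ c • u′) ⊕ (v ⊕ c • v′) ≡ (u ⊕ v) ⊕ c • (u′ ⊕ v′)
  ⊕-interchange c [] [] [] [] = refl
  ⊕-interchange c (x ∷ u) (y ∷ v) (x′ ∷ u′) (y′ ∷ v′) = cong₂ _∷_
    (𝔽.solve 5 (λ c x y x′ y′ → (x 𝔽.:+ c 𝔽.:* x′) 𝔽.:+ (y 𝔽.:+ c 𝔽.:* y′) 𝔽.:= (x 𝔽.:+ y) 𝔽.:+ c 𝔽.:* (x′ 𝔽.:+ y′))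
       refl c x y x′ y′)
    (⊕-interchange c u v u′ v′)

  -- The ring solver has coefficients in ℕ, so -1 enters its identities as a variable e,
  -- and the relation 1 + e ≡ 0 is applied afterwards.
  -1ᶠ : K
  -1ᶠ = -ᶠ 1ᶠ

  1-1 : 1ᶠ +ᶠ -1ᶠ ≡ 0ᶠ
  1-1 = -ᶠ-inverseʳ 1ᶠ

  [1-1]*≡0 : ∀ x → (1ᶠ +ᶠ -1ᶠ) *ᶠ x ≡ 0ᶠ
  [1-1]*≡0 x = trans (cong (_*ᶠ x) 1-1) (*ᶠ-zeroˡ x)

  -1+1 : -1ᶠ +ᶠ 1ᶠ ≡ 0ᶠ
  -1+1 = CommutativeRing.-‿inverseˡ ring 1ᶠ

  ⊖-inverse : ∀ {n} (v : Vec K n) → v ⊕ -1ᶠ • v ≡ 𝟎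
  ⊖-inverse v = begin
    v ⊕ -1ᶠ • v              ≡⟨ cong (_⊕ -1ᶠ • v) (sym (trans (⊕-identityˡ _) (•-identity v))) ⟩
    𝟎 ⊕ 1ᶠ • v ⊕ -1ᶠ • v     ≡⟨ ⊕-•-cancel 1-1 𝟎 v ⟩
    𝟎                        ∎

  ⊖-zero⇒≡ : ∀ {n} (u v : Vec K n) → u ⊕ -1ᶠ • v ≡ 𝟎 → u ≡ v
  ⊖-zero⇒≡ u v eq = begin
    u                        ≡⟨ sym (⊕-•-cancel -1+1 u v) ⟩
    u ⊕ -1ᶠ • v ⊕ 1ᶠ • v     ≡⟨ cong (_⊕ 1ᶠ • v) eq ⟩
    𝟎 ⊕ 1ᶠ • v               ≡⟨ trans (⊕-identityˡ _) (•-identity v) ⟩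
    v                        ∎

  difference-zero⇒≡ : ∀ {a b} → a +ᶠ -1ᶠ *ᶠ b ≡ 0ᶠ → a ≡ b
  difference-zero⇒≡ {a} {b} a-b≡0 = ∷-injectiveˡ (⊖-zero⇒≡ (a ∷ []) (b ∷ []) (cong (_∷ []) a-b≡0))

  scale-inverse : ∀ {n a b} → a *ᶠ b ≡ 1ᶠ → (v : Vec K n) → a • (b • v) ≡ v
  scale-inverse {a = a} {b} ab≡1 v = trans (•-assoc a b v) (trans (cong (_• v) ab≡1) (•-identity v))

  •-nonzero : ∀ {n a} {v : Vec K n} → a ≢ 0ᶠ → v ≢ 𝟎 → a • v ≢ 𝟎
  •-nonzero {a = a} {v} a≢0 v≢0 av≡0 with inverse a a≢0
  ... | a⁻¹ , aa⁻¹≡1 = v≢0 (begin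
    v                ≡⟨ sym (scale-inverse (trans (*ᶠ-comm a⁻¹ a) aa⁻¹≡1) v) ⟩
    a⁻¹ • (a • v)    ≡⟨ cong (a⁻¹ •_) av≡0 ⟩
    a⁻¹ • 𝟎          ≡⟨ •-zeroʳ a⁻¹ ⟩
    𝟎                ∎)

  -- The hyperbolic quadratic form and its polarisation

  Q : Vec K 6 → K
  Q = Qform F

  B : Vec K 6 → Vec K 6 → K
  B (a ∷ b ∷ c ∷ d ∷ e ∷ f ∷ []) (a′ ∷ b′ ∷ c′ ∷ d′ ∷ e′ ∷ f′ ∷ []) =
    (a *ᶠ b′ +ᶠ b *ᶠ a′) +ᶠ (c *ᶠ d′ +ᶠ d *ᶠ c′) +ᶠ (e *ᶠ f′ +ᶠ f *ᶠ e′)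

  private
    sum₃ : ∀ {x y z x′ y′ z′} → x ≡ x′ → y ≡ y′ → z ≡ z′ → x +ᶠ y +ᶠ z ≡ x′ +ᶠ y′ +ᶠ z′
    sum₃ p q r = cong₂ _+ᶠ_ (cong₂ _+ᶠ_ p q) r

  B-sym : ∀ u v → B u v ≡ B v u
  B-sym (a ∷ b ∷ c ∷ d ∷ e ∷ f ∷ []) (a′ ∷ b′ ∷ c′ ∷ d′ ∷ e′ ∷ f′ ∷ []) =
    sum₃ (swap a b a′ b′) (swap c d c′ d′) (swap e f e′ f′)
    where
    swap : ∀ a b a′ b′ → a *ᶠ b′ +ᶠ b *ᶠ a′ ≡ a′ *ᶠ b +ᶠ b′ *ᶠ a
    swap = 𝔽.solve 4 (λ a b a′ b′ → a 𝔽.:* b′ 𝔽.:+ b 𝔽.:* a′ 𝔽.:= a′ 𝔽.:* b 𝔽.:+ b′ 𝔽.:* a) refl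

  B-linearʳ : ∀ u v c w → B u (v ⊕ c • w) ≡ B u v +ᶠ c *ᶠ B u w
  B-linearʳ (u₁ ∷ u₂ ∷ u₃ ∷ u₄ ∷ u₅ ∷ u₆ ∷ []) (v₁ ∷ v₂ ∷ v₃ ∷ v₄ ∷ v₅ ∷ v₆ ∷ []) c
            (w₁ ∷ w₂ ∷ w₃ ∷ w₄ ∷ w₅ ∷ w₆ ∷ []) = trans
    (sum₃ (lin u₁ u₂ v₁ v₂ c w₁ w₂) (lin u₃ u₄ v₃ v₄ c w₃ w₄) (lin u₅ u₆ v₅ v₆ c w₅ w₆))
    (𝔽.solve 7 (λ x y z c x′ y′ z′ → x 𝔽.:+ c 𝔽.:* x′ 𝔽.:+ (y 𝔽.:+ c 𝔽.:* y′) 𝔽.:+ (z 𝔽.:+ c 𝔽.:* z′)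
                  𝔽.:= x 𝔽.:+ y 𝔽.:+ z 𝔽.:+ c 𝔽.:* (x′ 𝔽.:+ y′ 𝔽.:+ z′))
       refl _ _ _ c _ _ _)
    where
    lin : ∀ a b v₁ v₂ c w₁ w₂ → a *ᶠ (v₂ +ᶠ c *ᶠ w₂) +ᶠ b *ᶠ (v₁ +ᶠ c *ᶠ w₁)
                              ≡ (a *ᶠ v₂ +ᶠ b *ᶠ v₁) +ᶠ c *ᶠ (a *ᶠ w₂ +ᶠ b *ᶠ w₁)
    lin = 𝔽.solve 7 (λ a b v₁ v₂ c w₁ w₂ → a 𝔽.:* (v₂ 𝔽.:+ c 𝔽.:* w₂) 𝔽.:+ b 𝔽.:* (v₁ 𝔽.:+ c 𝔽.:* w₁)
                  𝔽.:= (a 𝔽.:* v₂ 𝔽.:+ b 𝔽.:* v₁) 𝔽.:+ c 𝔽.:* (a 𝔽.:* w₂ 𝔽.:+ b 𝔽.:* w₁)) refl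

  B-linearˡ : ∀ v c w u → B (v ⊕ c • w) u ≡ B v u +ᶠ c *ᶠ B w u
  B-linearˡ v c w u = trans (B-sym _ u) (trans (B-linearʳ u v c w) (cong₂ (λ x y → x +ᶠ c *ᶠ y) (B-sym u v) (B-sym u w)))

  -- The defining relation of the polarisation, valid in every characteristic; `Q` is never
  -- recovered from `B`, so no division by 2 occurs.
  Q-⊕• : ∀ u c v → Q (u ⊕ c • v) ≡ Q u +ᶠ c *ᶠ B u v +ᶠ c *ᶠ c *ᶠ Q v
  Q-⊕• (u₁ ∷ u₂ ∷ u₃ ∷ u₄ ∷ u₅ ∷ u₆ ∷ []) c (v₁ ∷ v₂ ∷ v₃ ∷ v₄ ∷ v₅ ∷ v₆ ∷ []) = trans
    (sum₃ (piece u₁ u₂ c v₁ v₂) (piece u₃ u₄ c v₃ v₄) (piece u₅ u₆ c v₅ v₆))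
    (𝔽.solve 10 (λ x y z c x′ y′ z′ x″ y″ z″ →
         (x 𝔽.:+ c 𝔽.:* x′ 𝔽.:+ c 𝔽.:* c 𝔽.:* x″) 𝔽.:+ (y 𝔽.:+ c 𝔽.:* y′ 𝔽.:+ c 𝔽.:* c 𝔽.:* y″)
            𝔽.:+ (z 𝔽.:+ c 𝔽.:* z′ 𝔽.:+ c 𝔽.:* c 𝔽.:* z″)
         𝔽.:= (x 𝔽.:+ y 𝔽.:+ z) 𝔽.:+ c 𝔽.:* (x′ 𝔽.:+ y′ 𝔽.:+ z′) 𝔽.:+ c 𝔽.:* c 𝔽.:* (x″ 𝔽.:+ y″ 𝔽.:+ z″))
       refl _ _ _ c _ _ _ _ _ _)
    where
    piece : ∀ a b c a′ b′ → (a +ᶠ c *ᶠ a′) *ᶠ (b +ᶠ c *ᶠ b′)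
                          ≡ a *ᶠ b +ᶠ c *ᶠ (a *ᶠ b′ +ᶠ b *ᶠ a′) +ᶠ c *ᶠ c *ᶠ (a′ *ᶠ b′)
    piece = 𝔽.solve 5 (λ a b c a′ b′ → (a 𝔽.:+ c 𝔽.:* a′) 𝔽.:* (b 𝔽.:+ c 𝔽.:* b′)
                          𝔽.:= a 𝔽.:* b 𝔽.:+ c 𝔽.:* (a 𝔽.:* b′ 𝔽.:+ b 𝔽.:* a′) 𝔽.:+ c 𝔽.:* c 𝔽.:* (a′ 𝔽.:* b′)) refl

  Q-𝟎 : Q 𝟎 ≡ 0ᶠ
  Q-𝟎 = 𝔽.solve 1 (λ z → 𝔽.con 0 𝔽.:* 𝔽.con 0 𝔽.:+ 𝔽.con 0 𝔽.:* 𝔽.con 0 𝔽.:+ 𝔽.con 0 𝔽.:* 𝔽.con 0 𝔽.:= 𝔽.con 0) refl 0ᶠ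

  B-𝟎ʳ : ∀ u → B u 𝟎 ≡ 0ᶠ
  B-𝟎ʳ u = begin
    B u 𝟎                          ≡⟨ cong (B u) (sym (⊖-inverse 𝟎)) ⟩
    B u (𝟎 ⊕ -1ᶠ • 𝟎)              ≡⟨ B-linearʳ u 𝟎 -1ᶠ 𝟎 ⟩
    B u 𝟎 +ᶠ -1ᶠ *ᶠ B u 𝟎          ≡⟨ 𝔽.solve 2 (λ e x → x 𝔽.:+ e 𝔽.:* x 𝔽.:= (𝔽.con 1 𝔽.:+ e) 𝔽.:* x) refl -1ᶠ (B u 𝟎) ⟩
    (1ᶠ +ᶠ -1ᶠ) *ᶠ B u 𝟎           ≡⟨ [1-1]*≡0 (B u 𝟎) ⟩
    0ᶠ                             ∎

  B-𝟎ˡ : ∀ u → B 𝟎 u ≡ 0ᶠ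
  B-𝟎ˡ u = trans (B-sym 𝟎 u) (B-𝟎ʳ u)

  B-•ʳ : ∀ u c w → B u (c • w) ≡ c *ᶠ B u w
  B-•ʳ u c w = begin
    B u (c • w)              ≡⟨ cong (B u) (sym (⊕-identityˡ (c • w))) ⟩
    B u (𝟎 ⊕ c • w)          ≡⟨ B-linearʳ u 𝟎 c w ⟩
    B u 𝟎 +ᶠ c *ᶠ B u w      ≡⟨ cong (_+ᶠ c *ᶠ B u w) (B-𝟎ʳ u) ⟩
    0ᶠ +ᶠ c *ᶠ B u w         ≡⟨ +ᶠ-identityˡ _ ⟩
    c *ᶠ B u w               ∎

  Q-• : ∀ c v → Q (c • v) ≡ c *ᶠ c *ᶠ Q v
  Q-• c v = begin
    Q (c • v)                                        ≡⟨ cong Q (sym (⊕-identityˡ (c • v))) ⟩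
    Q (𝟎 ⊕ c • v)                                    ≡⟨ Q-⊕• 𝟎 c v ⟩
    Q 𝟎 +ᶠ c *ᶠ B 𝟎 v +ᶠ c *ᶠ c *ᶠ Q v               ≡⟨ cong₂ (λ x y → x +ᶠ c *ᶠ y +ᶠ c *ᶠ c *ᶠ Q v) Q-𝟎 (B-𝟎ˡ v) ⟩
    0ᶠ +ᶠ c *ᶠ 0ᶠ +ᶠ c *ᶠ c *ᶠ Q v
      ≡⟨ 𝔽.solve 2 (λ c x → 𝔽.con 0 𝔽.:+ c 𝔽.:* 𝔽.con 0 𝔽.:+ c 𝔽.:* c 𝔽.:* x 𝔽.:= c 𝔽.:* c 𝔽.:* x) refl c (Q v) ⟩
    c *ᶠ c *ᶠ Q v                                    ∎

  B-self : ∀ v → B v v ≡ Q v +ᶠ Q v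
  B-self (a ∷ b ∷ c ∷ d ∷ e ∷ f ∷ []) = 𝔽.solve 6
    (λ a b c d e f → (a 𝔽.:* b 𝔽.:+ b 𝔽.:* a) 𝔽.:+ (c 𝔽.:* d 𝔽.:+ d 𝔽.:* c) 𝔽.:+ (e 𝔽.:* f 𝔽.:+ f 𝔽.:* e)
       𝔽.:= (a 𝔽.:* b 𝔽.:+ c 𝔽.:* d 𝔽.:+ e 𝔽.:* f) 𝔽.:+ (a 𝔽.:* b 𝔽.:+ c 𝔽.:* d 𝔽.:+ e 𝔽.:* f)) refl a b c d e f

  -- Pairing with a standard basis vector reads off the coordinate of its hyperbolic partner.
  B-nondegenerate : ∀ v → (∀ u → B u v ≡ 0ᶠ) → v ≡ 𝟎
  B-nondegenerate (a ∷ b ∷ c ∷ d ∷ e ∷ f ∷ []) Bv≡0 =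
    vec6 (coordinate _ (𝔽.solve 6 (λ a b c d e f → a 𝔽.:= form 0 1 0 0 0 0 a b c d e f) refl a b c d e f))
         (coordinate _ (𝔽.solve 6 (λ a b c d e f → b 𝔽.:= form 1 0 0 0 0 0 a b c d e f) refl a b c d e f))
         (coordinate _ (𝔽.solve 6 (λ a b c d e f → c 𝔽.:= form 0 0 0 1 0 0 a b c d e f) refl a b c d e f))
         (coordinate _ (𝔽.solve 6 (λ a b c d e f → d 𝔽.:= form 0 0 1 0 0 0 a b c d e f) refl a b c d e f))
         (coordinate _ (𝔽.solve 6 (λ a b c d e f → e 𝔽.:= form 0 0 0 0 0 1 a b c d e f) refl a b c d e f))
         (coordinate _ (𝔽.solve 6 (λ a b c d e f → f 𝔽.:= form 0 0 0 0 1 0 a b c d e f) refl a b c d e f))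
    where
    coordinate : ∀ {x} u → x ≡ B u (a ∷ b ∷ c ∷ d ∷ e ∷ f ∷ []) → x ≡ 0ᶠ
    coordinate u x≡ = trans x≡ (Bv≡0 u)

    -- `B` with a standard basis vector as first argument, in the syntax of the solver; the six
    -- numerals are the coordinates of that vector.
    form : ℕ → ℕ → ℕ → ℕ → ℕ → ℕ → (a b c d e f : 𝔽.Polynomial 6) → 𝔽.Polynomial 6
    form i j k l m n a b c d e f =
      (𝔽.con i 𝔽.:* b 𝔽.:+ 𝔽.con j 𝔽.:* a) 𝔽.:+ (𝔽.con k 𝔽.:* d 𝔽.:+ 𝔽.con l 𝔽.:* c) 𝔽.:+ (𝔽.con m 𝔽.:* f 𝔽.:+ 𝔽.con n 𝔽.:* e)

    vec6 : ∀ {a b c d e f a′ b′ c′ d′ e′ f′ : K} → a ≡ a′ → b ≡ b′ → c ≡ c′ → d ≡ d′ → e ≡ e′ → f ≡ f′ →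
      _≡_ {A = Vec K 6} (a ∷ b ∷ c ∷ d ∷ e ∷ f ∷ []) (a′ ∷ b′ ∷ c′ ∷ d′ ∷ e′ ∷ f′ ∷ [])
    vec6 refl refl refl refl refl refl = refl

  -- Scalars and vectors as finite types; zeros of affine functions.

  ∈-elems : ∀ a → a ∈ elems F
  ∈-elems a = subst (_∈ elems F) (Inverse.strictlyInverseˡ enum a) (∈-map⁺ (Inverse.to enum) (∈-allFin (Inverse.from enum a)))

  elems-complete : ∀ a → sum (elems F) (λ b → 𝟙 (does (a ≟ᶠ b))) ≡ 1ℚ
  elems-complete a = sum-δ-unique _≟ᶠ_ (Uniqueₚ.map⁺ to-injective (Uniqueₚ.allFin⁺ q))
    (∈-elems a)
    where
    to-injective : ∀ {i j} → Inverse.to enum i ≡ Inverse.to enum j → i ≡ j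
    to-injective {i} {j} eq = trans (sym (Inverse.strictlyInverseʳ enum i))
      (trans (cong (Inverse.from enum) eq) (Inverse.strictlyInverseʳ enum j))

  scalars : Enumeration K
  scalars = record { _≟_ = _≟ᶠ_ ; list = elems F ; sum-≟ = elems-complete }

  sum-allVecs : ∀ n (f : Vec K (suc n) → ℚ) →
    sum (allVecs F (suc n)) f ≡ sum (elems F) (λ a → sum (allVecs F n) (λ v → f (a ∷ v)))
  sum-allVecs n f = trans (sum-concatMap (λ a → map (a ∷_) (allVecs F n)) (elems F) f)
    (sum-cong (elems F) (λ a → sum-map (a ∷_) (allVecs F n) f))

  _≟ⱽ_ : ∀ {n} (u v : Vec K n) → Dec (u ≡ v)
  _≟ⱽ_ = ≡-dec _≟ᶠ_

  allVecs-complete : ∀ n (u : Vec K n) → sum (allVecs F n) (λ v → 𝟙 (does (u ≟ⱽ v))) ≡ 1ℚ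
  allVecs-complete zero [] = refl
  allVecs-complete (suc n) (a ∷ u) = begin
    sum (allVecs F (suc n)) (λ v → 𝟙 (does ((a ∷ u) ≟ⱽ v)))
      ≡⟨ sum-allVecs n _ ⟩
    -- Equality of nonempty vectors is decided coordinatewise, so the indicator factors.
    sum (elems F) (λ b → sum (allVecs F n) (λ v → 𝟙 (does (a ≟ᶠ b) ∧ does (u ≟ⱽ v))))
      ≡⟨ sum-cong (elems F) (λ b → trans (sum-cong (allVecs F n) (λ v → 𝟙-∧ (does (a ≟ᶠ b)) (does (u ≟ⱽ v))))
           (sum-* (allVecs F n) (𝟙 (does (a ≟ᶠ b))) _)) ⟩
    sum (elems F) (λ b → 𝟙 (does (a ≟ᶠ b)) * sum (allVecs F n) (λ v → 𝟙 (does (u ≟ⱽ v))))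
      ≡⟨ sum-cong (elems F) (λ b → trans (cong (𝟙 (does (a ≟ᶠ b)) *_) (allVecs-complete n u)) (ℚₚ.*-identityʳ _)) ⟩
    sum (elems F) (λ b → 𝟙 (does (a ≟ᶠ b)))
      ≡⟨ elems-complete a ⟩
    1ℚ ∎

  vectors : ∀ n → Enumeration (Vec K n)
  vectors n = record { _≟_ = _≟ⱽ_ ; list = allVecs F n ; sum-≟ = allVecs-complete n }

  module 𝕂 = Enumeration scalars
  module 𝕍 {n} = Enumeration (vectors n)
  open 𝕍 using (∑; δ)

  -- The size of the field obtained as a sum, so that counts produce it directly; `q̂≡` ties it to
  -- `q`.
  q̂ : ℚ
  q̂ = 𝕂.card

  infix 30 q̂^_
  q̂^_ : ℕ → ℚ
  q̂^ zero  = 1ℚ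
  q̂^ suc n = q̂ * q̂^ n

  card-vectors : ∀ n → 𝕍.card {n} ≡ q̂^ n
  card-vectors zero = refl
  card-vectors (suc n) = begin
    sum (allVecs F (suc n)) (λ _ → 1ℚ)                          ≡⟨ sum-allVecs n _ ⟩
    sum (elems F) (λ a → sum (allVecs F n) (λ _ → 1ℚ))          ≡⟨ sum-cong (elems F) (λ _ → trans (card-vectors n) (sym (ℚₚ.*-identityˡ _))) ⟩
    sum (elems F) (λ a → 1ℚ * q̂^ n)                             ≡⟨ sum-*ʳ (elems F) (q̂^ n) _ ⟩
    q̂ * q̂^ n                                                    ∎

  q̂≡ : q̂ ≡ ℕ→ℚ q
  q̂≡ = trans (sum-map (Inverse.to enum) (allFin q) (λ _ → 1ℚ))
      (trans (sum-length (allFin q)) (cong ℕ→ℚ (length-tabulate {n = q} (λ i → i))))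

  2≤q : 2 ℕ.≤ q
  2≤q = go q enum
    where
    Fin1-prop : ∀ (i j : Fin 1) → i ≡ j
    Fin1-prop zero zero = refl
    go : ∀ n → Fin n ↔ K → 2 ℕ.≤ n
    go 0 e with Inverse.from e 0ᶠ
    ... | ()
    go 1 e = ⊥-elim (0≢1 (begin
      0ᶠ                               ≡⟨ sym (Inverse.strictlyInverseˡ e 0ᶠ) ⟩
      Inverse.to e (Inverse.from e 0ᶠ) ≡⟨ cong (Inverse.to e) (Fin1-prop _ _) ⟩
      Inverse.to e (Inverse.from e 1ᶠ) ≡⟨ Inverse.strictlyInverseˡ e 1ᶠ ⟩
      1ᶠ                               ∎))
    go (suc (suc n)) e = ℕ.s≤s (ℕ.s≤s ℕ.z≤n)

  q̂≢ℕ : ∀ {n} → n ≢ q → q̂ ≢ ℕ→ℚ n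
  q̂≢ℕ n≢q eq = n≢q (ℕ→ℚ-injective (trans (sym eq) q̂≡))

  q̂≢0 : q̂ ≢ 0ℚ
  q̂≢0 = q̂≢ℕ (ℕₚ.<⇒≢ (ℕₚ.<-trans (ℕ.s≤s ℕ.z≤n) 2≤q))

  q̂-1≢0 : q̂ - 1ℚ ≢ 0ℚ
  q̂-1≢0 eq = q̂≢ℕ (ℕₚ.<⇒≢ 2≤q)
    (trans (solve 1 (λ q → q := q :- con 1ℚ :+ con 1ℚ) refl q̂) (cong (_+ 1ℚ) eq))

  q̂+1≢0 : q̂ + 1ℚ ≢ 0ℚ
  q̂+1≢0 eq = ℕₚ.m+1+n≢0 q (ℕ→ℚ-injective (trans (ℕ→ℚ-+ q 1) (trans (cong (_+ 1ℚ) (sym q̂≡)) eq)))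

  *-nonzero : ∀ {a b} → a ≢ 0ℚ → b ≢ 0ℚ → a * b ≢ 0ℚ
  *-nonzero {a} {b} a≢0 b≢0 ab≡0 = b≢0 (*-cancelˡ a a≢0 (trans ab≡0 (sym (ℚₚ.*-zeroʳ a))))

  zero? : K → ℚ
  zero? a = 𝟙 (isZero F a)

  ∑-translate : ∀ {n} c (r : Vec K n) (f : Vec K n → ℚ) → ∑ f ≡ ∑ (λ y → f (y ⊕ c • r))
  ∑-translate {n} c r = ∑-bijection (λ v → v ⊕ (-ᶠ c) • r , ⊕-•-cancel (CommutativeRing.-‿inverseˡ ring c) v r)
    where
    inj : ∀ {a b : Vec K n} → a ⊕ c • r ≡ b ⊕ c • r → a ≡ b
    inj {a} {b} eq = trans (sym (⊕-•-cancel (-ᶠ-inverseʳ c) a r))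
      (trans (cong (_⊕ (-ᶠ c) • r) eq) (⊕-•-cancel (-ᶠ-inverseʳ c) b r))
    open Injection (vectors n) (vectors n) (λ y → y ⊕ c • r) inj

  ∑-affine-line : ∀ d {c} → c ≢ 0ᶠ → 𝕂.∑ (λ t → zero? (d +ᶠ t *ᶠ c)) ≡ 1ℚ
  ∑-affine-line d {c} c≢0 with inverse c c≢0
  ... | c⁻¹ , cc⁻¹≡1 = trans
    (sum-cong (elems F) (λ t → 𝟙-⇔ ((d +ᶠ t *ᶠ c) ≟ᶠ 0ᶠ) (root ≟ᶠ t) (only t) (λ { refl → is-root })))
    (elems-complete root)
    where
    root : K
    root = -1ᶠ *ᶠ d *ᶠ c⁻¹
    is-root : d +ᶠ root *ᶠ c ≡ 0ᶠ
    is-root = begin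
      d +ᶠ -1ᶠ *ᶠ d *ᶠ c⁻¹ *ᶠ c      ≡⟨ 𝔽.solve 4 (λ e d c i → d 𝔽.:+ e 𝔽.:* d 𝔽.:* i 𝔽.:* c 𝔽.:= d 𝔽.:+ e 𝔽.:* d 𝔽.:* (c 𝔽.:* i)) refl -1ᶠ d c c⁻¹ ⟩
      d +ᶠ -1ᶠ *ᶠ d *ᶠ (c *ᶠ c⁻¹)    ≡⟨ cong (λ z → d +ᶠ -1ᶠ *ᶠ d *ᶠ z) cc⁻¹≡1 ⟩
      d +ᶠ -1ᶠ *ᶠ d *ᶠ 1ᶠ            ≡⟨ 𝔽.solve 2 (λ e d → d 𝔽.:+ e 𝔽.:* d 𝔽.:* 𝔽.con 1 𝔽.:= (𝔽.con 1 𝔽.:+ e) 𝔽.:* d) refl -1ᶠ d ⟩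
      (1ᶠ +ᶠ -1ᶠ) *ᶠ d               ≡⟨ [1-1]*≡0 d ⟩
      0ᶠ                             ∎
    only : ∀ t → d +ᶠ t *ᶠ c ≡ 0ᶠ → root ≡ t
    only t eq = begin
      -1ᶠ *ᶠ d *ᶠ c⁻¹                        ≡⟨ sym (+ᶠ-identityʳ _) ⟩
      -1ᶠ *ᶠ d *ᶠ c⁻¹ +ᶠ 0ᶠ                  ≡⟨ cong (-1ᶠ *ᶠ d *ᶠ c⁻¹ +ᶠ_) (sym (trans (cong (_*ᶠ c⁻¹) eq) (*ᶠ-zeroˡ c⁻¹))) ⟩
      -1ᶠ *ᶠ d *ᶠ c⁻¹ +ᶠ (d +ᶠ t *ᶠ c) *ᶠ c⁻¹
        ≡⟨ 𝔽.solve 5 (λ e d c i t → e 𝔽.:* d 𝔽.:* i 𝔽.:+ (d 𝔽.:+ t 𝔽.:* c) 𝔽.:* i 𝔽.:= (𝔽.con 1 𝔽.:+ e) 𝔽.:* (d 𝔽.:* i) 𝔽.:+ t 𝔽.:* (c 𝔽.:* i)) refl -1ᶠ d c c⁻¹ t ⟩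
      (1ᶠ +ᶠ -1ᶠ) *ᶠ (d *ᶠ c⁻¹) +ᶠ t *ᶠ (c *ᶠ c⁻¹)    ≡⟨ cong₂ (λ x y → x +ᶠ t *ᶠ y) ([1-1]*≡0 _) cc⁻¹≡1 ⟩
      0ᶠ +ᶠ t *ᶠ 1ᶠ                          ≡⟨ 𝔽.solve 1 (λ t → 𝔽.con 0 𝔽.:+ t 𝔽.:* 𝔽.con 1 𝔽.:= t) refl t ⟩
      t                                      ∎

  -- Averaging over the translates by multiples of r: along every such line g vanishes exactly once.
  count-zeros-on : ∀ {n} (w : Vec K n → ℚ) (g : Vec K n → K) r →
    (∀ y t → w (y ⊕ t • r) ≡ w y) →
    (c : Vec K n → K) → (∀ y t → g (y ⊕ t • r) ≡ g y +ᶠ t *ᶠ c y) → (∀ y → c y ≡ 0ᶠ → w y ≡ 0ℚ) →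
    q̂ * ∑ (λ y → w y * zero? (g y)) ≡ ∑ w
  count-zeros-on {n} w g r w-inv c g-affine w≡0 = begin
    q̂ * S                                                                   ≡⟨ ℚₚ.*-comm q̂ S ⟩
    S * q̂                                                                   ≡⟨ sym (sum-const (elems F) S) ⟩
    𝕂.∑ (λ _ → S)                                                           ≡⟨ sum-cong (elems F) (λ t → ∑-translate t r _) ⟩
    𝕂.∑ (λ t → ∑ (λ y → w (y ⊕ t • r) * zero? (g (y ⊕ t • r))))
      ≡⟨ sum-cong (elems F) (λ t → sum-cong (allVecs F n) (λ y → cong₂ (λ x z → x * zero? z) (w-inv y t) (g-affine y t))) ⟩
    𝕂.∑ (λ t → ∑ (λ y → w y * zero? (g y +ᶠ t *ᶠ c y)))                     ≡⟨ sum-swap (elems F) (allVecs F n) _ ⟩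
    ∑ (λ y → 𝕂.∑ (λ t → w y * zero? (g y +ᶠ t *ᶠ c y)))                     ≡⟨ sum-cong (allVecs F n) line ⟩
    ∑ w                                                                     ∎
    where
    S : ℚ
    S = ∑ (λ y → w y * zero? (g y))
    line : ∀ y → 𝕂.∑ (λ t → w y * zero? (g y +ᶠ t *ᶠ c y)) ≡ w y
    line y with c y ≟ᶠ 0ᶠ
    ... | yes cy≡0 = begin
      𝕂.∑ (λ t → w y * zero? (g y +ᶠ t *ᶠ c y))   ≡⟨ sum-* (elems F) (w y) _ ⟩
      w y * 𝕂.∑ (λ t → zero? (g y +ᶠ t *ᶠ c y))   ≡⟨ cong (_* 𝕂.∑ (λ t → zero? (g y +ᶠ t *ᶠ c y))) (w≡0 y cy≡0) ⟩
      0ℚ * 𝕂.∑ (λ t → zero? (g y +ᶠ t *ᶠ c y))    ≡⟨ ℚₚ.*-zeroˡ (𝕂.∑ (λ t → zero? (g y +ᶠ t *ᶠ c y))) ⟩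
      0ℚ                                          ≡⟨ sym (w≡0 y cy≡0) ⟩
      w y                                         ∎
    ... | no cy≢0 = trans (sum-* (elems F) (w y) _) (trans (cong (w y *_) (∑-affine-line (g y) cy≢0)) (ℚₚ.*-identityʳ (w y)))

  -- A hyperplane count without a basis: one direction of nonzero slope cuts the space into lines,
  -- each with exactly one zero.
  count-affine : ∀ {n} (g : Vec K (suc n) → K) r {c} → c ≢ 0ᶠ →
    (∀ y t → g (y ⊕ t • r) ≡ g y +ᶠ t *ᶠ c) → ∑ (λ y → zero? (g y)) ≡ q̂^ n
  count-affine {n} g r {c} c≢0 affine = *-cancelˡ q̂ q̂≢0 (begin
    q̂ * ∑ (λ y → zero? (g y))         ≡⟨ cong (q̂ *_) (sum-cong (allVecs F (suc n)) (λ y → sym (ℚₚ.*-identityˡ (zero? (g y))))) ⟩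
    q̂ * ∑ (λ y → 1ℚ * zero? (g y))    ≡⟨ count-zeros-on (λ _ → 1ℚ) g r (λ _ _ → refl) (λ _ → c) affine (λ _ c≡0 → ⊥-elim (c≢0 c≡0)) ⟩
    𝕍.card {suc n}                    ≡⟨ card-vectors (suc n) ⟩
    q̂^ (suc n)                          ∎)

  -- Normalised representatives of projective points

  private
    N : ∀ {n} → Vec K n → Bool
    N = isNormalised F

    N-zero : ∀ {n x} (v : Vec K n) → x ≡ 0ᶠ → N (x ∷ v) ≡ N v
    N-zero {x = x} v x≡0 rewrite true-does (x ≟ᶠ 0ᶠ) x≡0 = refl

    N-nonzero : ∀ {n x} (v : Vec K n) → x ≢ 0ᶠ → N (x ∷ v) ≡ does (x ≟ᶠ 1ᶠ)
    N-nonzero {x = x} v x≢0 with x ≟ᶠ 0ᶠ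
    ... | yes x≡0 = ⊥-elim (x≢0 x≡0)
    ... | no _    = refl

  N-𝟎 : ∀ n → N (𝟎 {n}) ≡ false
  N-𝟎 zero    = refl
  N-𝟎 (suc n) = trans (N-zero (𝟎 {n}) refl) (N-𝟎 n)

  normalised⇒nonzero : ∀ {n} {v : Vec K n} → N v ≡ true → v ≢ 𝟎
  normalised⇒nonzero {n} Nv refl with trans (sym Nv) (N-𝟎 n)
  ... | ()

  -- The scalar is the inverse of the first nonzero coordinate.
  normaliser : ∀ {n} (v : Vec K n) → v ≢ 𝟎 →
    ∃ λ c → N (c • v) ≡ true × (∀ d → N (d • v) ≡ true → d ≡ c)
  normaliser [] []≢ = ⊥-elim ([]≢ refl)
  normaliser (a ∷ v) av≢0 with a ≟ᶠ 0ᶠ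
  ... | yes refl with normaliser v (λ v≡0 → av≢0 (cong (0ᶠ ∷_) v≡0))
  ...   | c , Nc , unique = c , trans (skip c) Nc , λ d Nd → unique d (trans (sym (skip d)) Nd)
    where
    skip : ∀ c → N (c • (0ᶠ ∷ v)) ≡ N (c • v)
    skip c = N-zero (c • v) (*ᶠ-zeroʳ c)
  normaliser (a ∷ v) av≢0 | no a≢0 with inverse a a≢0
  ... | a⁻¹ , aa⁻¹≡1 = a⁻¹ , trans (N-nonzero (a⁻¹ • v) a⁻¹a≢0) (true-does (_ ≟ᶠ 1ᶠ) a⁻¹a≡1) , unique
    where
    a⁻¹a≡1 : a⁻¹ *ᶠ a ≡ 1ᶠ
    a⁻¹a≡1 = trans (*ᶠ-comm a⁻¹ a) aa⁻¹≡1
    a⁻¹a≢0 : a⁻¹ *ᶠ a ≢ 0ᶠ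
    a⁻¹a≢0 eq = 0≢1 (trans (sym eq) a⁻¹a≡1)
    unique : ∀ d → N (d • (a ∷ v)) ≡ true → d ≡ a⁻¹
    unique d Nd with d ≟ᶠ 0ᶠ
    ... | yes refl = ⊥-elim (normalised⇒nonzero {v = 0ᶠ • (a ∷ v)} Nd (•-zeroˡ (a ∷ v)))
    ... | no d≢0 = begin
      d                  ≡⟨ 𝔽.solve 1 (λ d → d 𝔽.:= d 𝔽.:* 𝔽.con 1) refl d ⟩
      d *ᶠ 1ᶠ            ≡⟨ cong (d *ᶠ_) (sym aa⁻¹≡1) ⟩
      d *ᶠ (a *ᶠ a⁻¹)    ≡⟨ sym (*ᶠ-assoc d a a⁻¹) ⟩
      d *ᶠ a *ᶠ a⁻¹      ≡⟨ cong (_*ᶠ a⁻¹) (does-true (_ ≟ᶠ 1ᶠ) (trans (sym (N-nonzero (d • v) (*ᶠ-nonzero d≢0 a≢0))) Nd)) ⟩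
      1ᶠ *ᶠ a⁻¹          ≡⟨ *ᶠ-identityˡ a⁻¹ ⟩
      a⁻¹                ∎

  normaliser-nonzero : ∀ {n c} {v : Vec K n} → N (c • v) ≡ true → c ≢ 0ᶠ
  normaliser-nonzero {v = v} Ncv refl = normalised⇒nonzero {v = 0ᶠ • v} Ncv (•-zeroˡ v)

  -- The degree-zero homogeneous extension of f from normalised vectors to all vectors.
  ext : ∀ {n} → (Vec K n → ℚ) → Vec K n → ℚ
  ext f v = 𝕂.∑ (λ c → 𝟙 (N (c • v)) * f (c • v))

  ext-at : ∀ {n} (f : Vec K n → ℚ) c v → v ≢ 𝟎 → N (c • v) ≡ true → ext f v ≡ f (c • v)
  ext-at f c v v≢0 Ncv = trans (sum-cong (elems F) (λ d → cong (_* f (d • v)) (pick d))) (𝕂.∑-δ c (λ d → f (d • v)))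
    where
    pick : ∀ d → 𝟙 (N (d • v)) ≡ 𝕂.δ c d
    pick d with c ≟ᶠ d | N (d • v) in Ndv
    ... | yes refl | b     = cong 𝟙 (trans (sym Ndv) Ncv)
    ... | no _     | false = refl
    ... | no c≢d   | true  with normaliser v v≢0
    ...   | _ , _ , unique = ⊥-elim (c≢d (trans (unique c Ncv) (sym (unique d Ndv))))

  ext-𝟎 : ∀ {n} (f : Vec K n → ℚ) → ext f 𝟎 ≡ 0ℚ
  ext-𝟎 {n} f = trans (sum-cong (elems F) (λ c → trans
    (cong (λ b → 𝟙 b * f (c • 𝟎 {n})) (trans (cong N (•-zeroʳ {n} c)) (N-𝟎 n))) (ℚₚ.*-zeroˡ (f (c • 𝟎))))) (sum-0 (elems F))

  ext-normalised : ∀ {n} (f : Vec K n → ℚ) v → N v ≡ true → ext f v ≡ f v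
  ext-normalised f v Nv = trans
    (ext-at f 1ᶠ v (normalised⇒nonzero Nv) (trans (cong N (•-identity v)) Nv)) (cong f (•-identity v))

  ext-• : ∀ {n} (f : Vec K n → ℚ) {c} v → c ≢ 0ᶠ → ext f (c • v) ≡ ext f v
  ext-• f {c} v c≢0 with v ≟ⱽ 𝟎
  ... | yes refl = cong (ext f) (•-zeroʳ c)
  ... | no v≢0 with normaliser (c • v) (•-nonzero c≢0 v≢0)
  ...   | d , Nd , _ = begin
    ext f (c • v)       ≡⟨ ext-at f d (c • v) (•-nonzero c≢0 v≢0) Nd ⟩
    f (d • (c • v))     ≡⟨ cong f (•-assoc d c v) ⟩
    f ((d *ᶠ c) • v)    ≡⟨ sym (ext-at f (d *ᶠ c) v v≢0 (trans (cong N (sym (•-assoc d c v))) Nd)) ⟩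
    ext f v             ∎

  ∑-• : ∀ {n c} → c ≢ 0ᶠ → (f : Vec K n → ℚ) → ∑ (λ v → f (c • v)) ≡ ∑ f
  ∑-• {n} {c} c≢0 f with inverse c c≢0
  ... | c⁻¹ , cc⁻¹≡1 = sym (∑-bijection (λ v → c⁻¹ • v , scale-inverse cc⁻¹≡1 v) f)
    where
    c⁻¹c≡1 : c⁻¹ *ᶠ c ≡ 1ᶠ
    c⁻¹c≡1 = trans (*ᶠ-comm c⁻¹ c) cc⁻¹≡1
    inj : ∀ {u v : Vec K n} → c • u ≡ c • v → u ≡ v
    inj {u} {v} eq = trans (sym (scale-inverse c⁻¹c≡1 u)) (trans (cong (c⁻¹ •_) eq) (scale-inverse c⁻¹c≡1 v))
    open Injection (vectors n) (vectors n) (c •_) inj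

  -- After the sums are exchanged, each of the q - 1 nonzero scalars only permutes the vectors, and
  -- the scalar 0 contributes nothing because the zero vector is not normalised.
  ∑-ext : ∀ {n} (f : Vec K n → ℚ) → ∑ (ext f) ≡ (q̂ - 1ℚ) * ∑ (λ v → 𝟙 (N v) * f v)
  ∑-ext {n} f = trans (sum-swap (allVecs F n) (elems F) _)
    (begin
      𝕂.∑ (λ c → ∑ (λ v → g (c • v)))                       ≡⟨ 𝕂.∑-constant-off 0ᶠ (λ c → ∑ (λ v → g (c • v))) (∑ g) (λ c c≢0 → ∑-• c≢0 g) ⟩
      ∑ (λ v → g (0ᶠ • v)) + (q̂ - 1ℚ) * ∑ g                 ≡⟨ cong (_+ (q̂ - 1ℚ) * ∑ g) (trans (sum-cong (allVecs F n) zero-scaled) (sum-0 (allVecs F n))) ⟩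
      0ℚ + (q̂ - 1ℚ) * ∑ g                                   ≡⟨ ℚₚ.+-identityˡ _ ⟩
      (q̂ - 1ℚ) * ∑ g                                        ∎)
    where
    g : Vec K n → ℚ
    g v = 𝟙 (N v) * f v
    zero-scaled : ∀ v → g (0ᶠ • v) ≡ 0ℚ
    zero-scaled v = trans (cong (λ b → 𝟙 b * f (0ᶠ • v)) (trans (cong N (•-zeroˡ v)) (N-𝟎 n))) (ℚₚ.*-zeroˡ (f (0ᶠ • v)))

  -- The passage from vectors to points: away from `𝟎` a homogeneous function agrees with its own
  -- extension `ext f`, whose sum is known.
  ∑-projective : ∀ {n} (f : Vec K n → ℚ) → (∀ {c} v → c ≢ 0ᶠ → f (c • v) ≡ f v) →
    ∑ f ≡ f 𝟎 + (q̂ - 1ℚ) * ∑ (λ v → 𝟙 (N v) * f v)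
  ∑-projective {n} f f-• = begin
    ∑ f                                       ≡⟨ sum-cong (allVecs F n) split ⟩
    ∑ (λ v → δ 𝟎 v * f v + ext f v)           ≡⟨ sum-+ (allVecs F n) _ _ ⟩
    ∑ (λ v → δ 𝟎 v * f v) + ∑ (ext f)         ≡⟨ cong₂ _+_ (𝕍.∑-δ 𝟎 f) (∑-ext f) ⟩
    f 𝟎 + (q̂ - 1ℚ) * ∑ (λ v → 𝟙 (N v) * f v)  ∎
    where
    split : ∀ v → f v ≡ δ 𝟎 v * f v + ext f v
    split v with 𝟎 ≟ⱽ v
    ... | yes refl = sym (trans (cong (1ℚ * f 𝟎 +_) (ext-𝟎 f)) (trans (ℚₚ.+-identityʳ (1ℚ * f 𝟎)) (ℚₚ.*-identityˡ (f 𝟎))))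
    ... | no 0≢v with normaliser v (0≢v ∘ sym)
    ...   | c , Nc , _ = begin
      f v                    ≡⟨ sym (f-• v (normaliser-nonzero {v = v} Nc)) ⟩
      f (c • v)              ≡⟨ sym (ext-at f c v (0≢v ∘ sym) Nc) ⟩
      ext f v                ≡⟨ solve 2 (λ a b → b := con 0ℚ :* a :+ b) refl (f v) (ext f v) ⟩
      0ℚ * f v + ext f v     ∎

  zero?-scale : ∀ {c} a → c ≢ 0ᶠ → zero? (c *ᶠ a) ≡ zero? a
  zero?-scale {c} a c≢0 = 𝟙-⇔ ((c *ᶠ a) ≟ᶠ 0ᶠ) (a ≟ᶠ 0ᶠ)
    (λ ca≡0 → decidable-stable (a ≟ᶠ 0ᶠ) (λ a≢0 → *ᶠ-nonzero c≢0 a≢0 ca≡0))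
    (λ { refl → *ᶠ-zeroʳ c })

  zero?-yes : ∀ {a} → a ≡ 0ᶠ → zero? a ≡ 1ℚ
  zero?-yes {a} = 𝟙-yes (a ≟ᶠ 0ᶠ)

  -- Nondegeneracy supplies a direction of nonzero slope. The summand `0ᶠ` keeps the affine shape in
  -- which the plane counts are stated.
  count-linear : ∀ v → v ≢ 𝟎 → ∑ (λ u → zero? (0ᶠ +ᶠ B v u)) ≡ q̂^ 5
  count-linear v v≢0 with 𝕍.search (λ u → ¬? (B u v ≟ᶠ 0ᶠ))
  ... | no ¬e = ⊥-elim (v≢0 (B-nondegenerate v (λ u → decidable-stable (B u v ≟ᶠ 0ᶠ) (λ ≢0 → ¬e (u , ≢0)))))
  ... | yes (r , Brv≢0) = count-affine (λ u → 0ᶠ +ᶠ B v u) r (Brv≢0 ∘ trans (B-sym r v)) λ u t → begin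
      0ᶠ +ᶠ B v (u ⊕ t • r)               ≡⟨ cong (0ᶠ +ᶠ_) (B-linearʳ v u t r) ⟩
      0ᶠ +ᶠ (B v u +ᶠ t *ᶠ B v r)         ≡⟨ 𝔽.solve 2 (λ x y → 𝔽.con 0 𝔽.:+ (x 𝔽.:+ y) 𝔽.:= 𝔽.con 0 𝔽.:+ x 𝔽.:+ y) refl (B v u) (t *ᶠ B v r) ⟩
      0ᶠ +ᶠ B v u +ᶠ t *ᶠ B v r           ∎

  -- Totally singular planes

  -- An injective linear parametrisation by K³, rather than a subset, turns sums over a plane into
  -- sums over `Vec K 3`.
  record Plane : Set where
    field
      m          : Vec K 3 → Vec K 6
      m-linear   : ∀ a c b → m (a ⊕ c • b) ≡ m a ⊕ c • m b
      m-kernel   : ∀ a → m a ≡ 𝟎 → a ≡ 𝟎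
      m-singular : ∀ a → Q (m a) ≡ 0ᶠ

    m-𝟎 : m 𝟎 ≡ 𝟎
    m-𝟎 = begin
      m 𝟎                  ≡⟨ cong m (sym (⊖-inverse 𝟎)) ⟩
      m (𝟎 ⊕ -1ᶠ • 𝟎)      ≡⟨ m-linear 𝟎 -1ᶠ 𝟎 ⟩
      m 𝟎 ⊕ -1ᶠ • m 𝟎      ≡⟨ ⊖-inverse (m 𝟎) ⟩
      𝟎                    ∎

    m-• : ∀ c a → m (c • a) ≡ c • m a
    m-• c a = begin
      m (c • a)        ≡⟨ cong m (sym (⊕-identityˡ (c • a))) ⟩
      m (𝟎 ⊕ c • a)    ≡⟨ m-linear 𝟎 c a ⟩
      m 𝟎 ⊕ c • m a    ≡⟨ cong (_⊕ c • m a) m-𝟎 ⟩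
      𝟎 ⊕ c • m a      ≡⟨ ⊕-identityˡ _ ⟩
      c • m a          ∎

    m-injective : ∀ {a b} → m a ≡ m b → a ≡ b
    m-injective {a} {b} eq = ⊖-zero⇒≡ a b (m-kernel _ (begin
      m (a ⊕ -1ᶠ • b)      ≡⟨ m-linear a -1ᶠ b ⟩
      m a ⊕ -1ᶠ • m b      ≡⟨ cong (_⊕ -1ᶠ • m b) eq ⟩
      m b ⊕ -1ᶠ • m b      ≡⟨ ⊖-inverse (m b) ⟩
      𝟎                    ∎))

    open Injection (vectors 3) (vectors 6) m m-injective public
      renaming (image? to span?; ∑-image to ∑-span)

    ω : Vec K 6 → ℚ
    ω v = 𝟙 (does (span? v))

    -- Polarisation: `Q` vanishes at both vectors and at their sum.
    m-isotropic : ∀ a b → B (m a) (m b) ≡ 0ᶠ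
    m-isotropic a b = begin
      B (m a) (m b)                   ≡⟨ 𝔽.solve 1 (λ x → x 𝔽.:= 𝔽.con 0 𝔽.:+ 𝔽.con 1 𝔽.:* x 𝔽.:+ 𝔽.con 1 𝔽.:* 𝔽.con 1 𝔽.:* 𝔽.con 0) refl (B (m a) (m b)) ⟩
      0ᶠ +ᶠ 1ᶠ *ᶠ B (m a) (m b) +ᶠ 1ᶠ *ᶠ 1ᶠ *ᶠ 0ᶠ
        ≡⟨ cong₂ (λ x y → x +ᶠ 1ᶠ *ᶠ B (m a) (m b) +ᶠ 1ᶠ *ᶠ 1ᶠ *ᶠ y) (sym (m-singular a)) (sym (m-singular b)) ⟩
      Q (m a) +ᶠ 1ᶠ *ᶠ B (m a) (m b) +ᶠ 1ᶠ *ᶠ 1ᶠ *ᶠ Q (m b)   ≡⟨ sym (Q-⊕• (m a) 1ᶠ (m b)) ⟩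
      Q (m a ⊕ 1ᶠ • m b)              ≡⟨ cong Q (sym (m-linear a 1ᶠ b)) ⟩
      Q (m (a ⊕ 1ᶠ • b))              ≡⟨ m-singular _ ⟩
      0ᶠ                              ∎

    -- The offset `d` serves the count of singular vectors, where `Q` restricted to a coset of the
    -- plane is affine with constant term `Q v`.
    count-not-perp : ∀ d v → (∃ λ a → B (m a) v ≢ 0ᶠ) → ∑ (λ a → zero? (d +ᶠ B (m a) v)) ≡ q̂^ 2
    count-not-perp d v (r , Brv≢0) = count-affine (λ a → d +ᶠ B (m a) v) r Brv≢0 λ a t → begin
      d +ᶠ B (m (a ⊕ t • r)) v                  ≡⟨ cong (λ z → d +ᶠ B z v) (m-linear a t r) ⟩
      d +ᶠ B (m a ⊕ t • m r) v                  ≡⟨ cong (d +ᶠ_) (B-linearˡ (m a) t (m r) v) ⟩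
      d +ᶠ (B (m a) v +ᶠ t *ᶠ B (m r) v)        ≡⟨ 𝔽.solve 3 (λ d x y → d 𝔽.:+ (x 𝔽.:+ y) 𝔽.:= d 𝔽.:+ x 𝔽.:+ y) refl d (B (m a) v) (t *ᶠ B (m r) v) ⟩
      d +ᶠ B (m a) v +ᶠ t *ᶠ B (m r) v          ∎

    count-perp : ∀ v → (∀ a → B (m a) v ≡ 0ᶠ) → ∑ (λ a → zero? (0ᶠ +ᶠ B (m a) v)) ≡ q̂^ 3
    count-perp v perp = trans
      (sum-cong (allVecs F 3) (λ a → zero?-yes (trans (+ᶠ-identityˡ (B (m a) v)) (perp a)))) (card-vectors 3)

    not-perp? : ∀ v → Dec (∃ λ a → B (m a) v ≢ 0ᶠ)
    not-perp? v = 𝕍.search (λ a → ¬? (B (m a) v ≟ᶠ 0ᶠ))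

    perp? : ∀ v → Dec (∀ a → B (m a) v ≡ 0ᶠ)
    perp? v with not-perp? v
    ... | yes (a , ≢0) = no (λ perp → ≢0 (perp a))
    ... | no ¬e        = yes (λ a → decidable-stable (B (m a) v ≟ᶠ 0ᶠ) (λ ≢0 → ¬e (a , ≢0)))

    ¬perp⇒ : ∀ v → ¬ (∀ a → B (m a) v ≡ 0ᶠ) → ∃ λ a → B (m a) v ≢ 0ᶠ
    ¬perp⇒ v ¬perp = decidable-stable (not-perp? v) λ ¬e →
      ¬perp (λ a → decidable-stable (B (m a) v ≟ᶠ 0ᶠ) (λ ≢0 → ¬e (a , ≢0)))

    -- Double counting orthogonal pairs (a , v) shows that the orthogonal complement has q³ vectors.
    card-perp : ∑ (λ v → 𝟙 (does (perp? v))) ≡ q̂^ 3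
    card-perp = *-cancelˡ (q̂ * q̂ * (q̂ - 1ℚ)) (*-nonzero (*-nonzero q̂≢0 q̂≢0) q̂-1≢0) (begin
      q̂ * q̂ * (q̂ - 1ℚ) * θ
        ≡⟨ solve 2 (λ q θ → q :* q :* (q :- con 1ℚ) :* θ :=
             (pow 2 q :* pow 6 q :+ (pow 3 q :- pow 2 q) :* θ) :- pow 2 q :* pow 6 q) refl q̂ θ ⟩
      (q̂^ 2 * q̂^ 6 + (q̂^ 3 - q̂^ 2) * θ) - q̂^ 2 * q̂^ 6     ≡⟨ cong (_- q̂^ 2 * q̂^ 6) (trans (sym by-v) by-a) ⟩
      (q̂^ 5 * q̂^ 3 + (q̂^ 6 - q̂^ 5)) - q̂^ 2 * q̂^ 6
        ≡⟨ solve 1 (λ q → (pow 5 q :* pow 3 q :+ (pow 6 q :- pow 5 q)) :- pow 2 q :* pow 6 q :=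
             q :* q :* (q :- con 1ℚ) :* pow 3 q) refl q̂ ⟩
      q̂ * q̂ * (q̂ - 1ℚ) * q̂^ 3                           ∎)
      where
      pow : ∀ {n} → ℕ → Polynomial n → Polynomial n
      pow zero    x = con 1ℚ
      pow (suc k) x = x :* pow k x

      θ pairs : ℚ
      θ = ∑ (λ v → 𝟙 (does (perp? v)))
      pairs = ∑ (λ v → ∑ (λ a → zero? (0ᶠ +ᶠ B (m a) v)))

      for-v : ∀ v → ∑ (λ a → zero? (0ᶠ +ᶠ B (m a) v)) ≡ q̂^ 2 + (q̂^ 3 - q̂^ 2) * 𝟙 (does (perp? v))
      for-v v with perp? v
      ... | yes perp = trans (count-perp v perp) (solve 2 (λ x y → x := y :+ (x :- y) :* con 1ℚ) refl (q̂^ 3) (q̂^ 2))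
      ... | no ¬perp = trans (count-not-perp 0ᶠ v (¬perp⇒ v ¬perp))
                             (solve 2 (λ x y → y := y :+ (x :- y) :* con 0ℚ) refl (q̂^ 3) (q̂^ 2))

      for-a : ∀ a → ∑ (λ v → zero? (0ᶠ +ᶠ B (m a) v)) ≡ q̂^ 5 + (q̂^ 6 - q̂^ 5) * δ 𝟎 a
      for-a a with 𝟎 ≟ⱽ a
      ... | yes refl = trans (sum-cong (allVecs F 6) (λ v → zero?-yes (trans (+ᶠ-identityˡ _) (trans (cong (λ z → B z v) m-𝟎) (B-𝟎ˡ v)))))
                      (trans (card-vectors 6) (solve 2 (λ x y → x := y :+ (x :- y) :* con 1ℚ) refl (q̂^ 6) (q̂^ 5)))
      ... | no 0≢a = trans (count-linear (m a) (0≢a ∘ sym ∘ m-kernel a))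
                      (solve 2 (λ x y → y := y :+ (x :- y) :* con 0ℚ) refl (q̂^ 6) (q̂^ 5))

      by-v : pairs ≡ q̂^ 2 * q̂^ 6 + (q̂^ 3 - q̂^ 2) * θ
      by-v = begin
        pairs                                                                      ≡⟨ sum-cong (allVecs F 6) for-v ⟩
        ∑ (λ v → q̂^ 2 + (q̂^ 3 - q̂^ 2) * 𝟙 (does (perp? v)))                       ≡⟨ sum-+ (allVecs F 6) _ _ ⟩
        ∑ {6} (λ _ → q̂^ 2) + ∑ (λ v → (q̂^ 3 - q̂^ 2) * 𝟙 (does (perp? v)))
          ≡⟨ cong₂ _+_ (trans (sum-const (allVecs F 6) (q̂^ 2)) (cong (q̂^ 2 *_) (card-vectors 6))) (sum-* (allVecs F 6) (q̂^ 3 - q̂^ 2) _) ⟩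
        q̂^ 2 * q̂^ 6 + (q̂^ 3 - q̂^ 2) * θ                                             ∎

      by-a : pairs ≡ q̂^ 5 * q̂^ 3 + (q̂^ 6 - q̂^ 5)
      by-a = begin
        pairs                                                       ≡⟨ sum-swap (allVecs F 6) (allVecs F 3) _ ⟩
        ∑ (λ a → ∑ (λ v → zero? (0ᶠ +ᶠ B (m a) v)))                ≡⟨ sum-cong (allVecs F 3) for-a ⟩
        ∑ {3} (λ a → q̂^ 5 + (q̂^ 6 - q̂^ 5) * δ 𝟎 a)                      ≡⟨ sum-+ (allVecs F 3) _ _ ⟩
        ∑ {3} (λ _ → q̂^ 5) + ∑ {3} (λ a → (q̂^ 6 - q̂^ 5) * δ 𝟎 a)
          ≡⟨ cong₂ _+_ (trans (sum-const (allVecs F 3) (q̂^ 5)) (cong (q̂^ 5 *_) (card-vectors 3)))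
                       (trans (sum-* (allVecs F 3) (q̂^ 6 - q̂^ 5) _)
                       (trans (cong ((q̂^ 6 - q̂^ 5) *_) (𝕍.sum-≟ (𝟎 {3}))) (ℚₚ.*-identityʳ (q̂^ 6 - q̂^ 5)))) ⟩
        q̂^ 5 * q̂^ 3 + (q̂^ 6 - q̂^ 5)                                ∎

    card-span : ∑ ω ≡ q̂^ 3
    card-span = trans (sum-cong (allVecs F 6) (λ v → sym (ℚₚ.*-identityʳ (ω v))))
      (trans (sym (∑-span (λ _ → 1ℚ))) (card-vectors 3))

    -- A totally singular plane lies in its orthogonal complement, and both have q³ vectors, so the
    -- plane is its own complement.
    perp⇒span : ∀ v → (∀ a → B (m a) v ≡ 0ᶠ) → ∃ λ a → m a ≡ v
    perp⇒span v perp = 𝟙≡1⇒ (span? v) (trans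
      (𝕍.≤∧∑≡⇒≡ ω (λ v → 𝟙 (does (perp? v)))
        (λ v → 𝟙-≤ (span? v) (perp? v) (λ { (b , refl) a → m-isotropic a b }))
        (trans card-span (sym card-perp)) v)
      (𝟙-yes (perp? v) perp))

    -- Off the plane the affine function is not constant, because the plane is its own orthogonal
    -- complement. On the plane it is constantly `d`, hence the proviso that `d` vanishes there.
    count-affine-perp : ∀ d v → ((∃ λ a → m a ≡ v) → d ≡ 0ᶠ) →
      ∑ (λ a → zero? (d +ᶠ B (m a) v)) ≡ q̂^ 2 + (q̂^ 3 - q̂^ 2) * ω v
    count-affine-perp d v d≡0 with span? v
    ... | yes (b , refl) rewrite d≡0 (b , refl) = trans (count-perp (m b) (λ a → m-isotropic a b))
        (solve 2 (λ x y → x := y :+ (x :- y) :* con 1ℚ) refl (q̂^ 3) (q̂^ 2))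
    ... | no ¬span = trans (count-not-perp d v (¬perp⇒ v (¬span ∘ perp⇒span v)))
        (solve 2 (λ x y → y := y :+ (x :- y) :* con 0ℚ) refl (q̂^ 3) (q̂^ 2))

    count-plane-perp : ∀ v → ∑ (λ a → zero? (B (m a) v)) ≡ q̂^ 2 + (q̂^ 3 - q̂^ 2) * ω v
    count-plane-perp v = trans (sum-cong (allVecs F 3) (λ a → cong zero? (sym (+ᶠ-identityˡ (B (m a) v)))))
      (count-affine-perp 0ᶠ v (λ _ → refl))

  -- Counting points of the quadric

  ∑ᵖ : (Vec K 6 → ℚ) → ℚ
  ∑ᵖ = sum (points F)

  ∑ᵖ≡∑ : ∀ (f : Vec K 6 → ℚ) → ∑ᵖ f ≡ ∑ (λ v → 𝟙 (isPoint F v) * f v)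
  ∑ᵖ≡∑ = sum-filter (isPoint F) (allVecs F 6)

  point-normalised : ∀ {v} → IsPoint F v → isNormalised F v ≡ true
  point-normalised {v} pt with isNormalised F v
  ... | true = refl

  point-singular : ∀ {v} → IsPoint F v → Q v ≡ 0ᶠ
  point-singular {v} pt with isNormalised F v
  ... | true = does-true (Q v ≟ᶠ 0ᶠ) pt

  point-intro : ∀ {v} → isNormalised F v ≡ true → Q v ≡ 0ᶠ → IsPoint F v
  point-intro {v} Nv Qv≡0 = cong₂ _∧_ Nv (true-does (Q v ≟ᶠ 0ᶠ) Qv≡0)

  point-nonzero : ∀ {v} → IsPoint F v → v ≢ 𝟎
  point-nonzero {v} pt = normalised⇒nonzero (point-normalised {v} pt)

  ∑ᵖ-cong : ∀ {f g : Vec K 6 → ℚ} → (∀ p → IsPoint F p → f p ≡ g p) → ∑ᵖ f ≡ ∑ᵖ g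
  ∑ᵖ-cong {f} {g} f≡g = trans (∑ᵖ≡∑ f)
    (trans (sum-cong (allVecs F 6) (λ v → 𝟙-guard (isPoint F v) (f≡g v))) (sym (∑ᵖ≡∑ g)))

  ∑ᵖ-δ : ∀ (f : Vec K 6 → ℚ) r → IsPoint F r → ∑ᵖ (λ p → f p * δ p r) ≡ f r
  ∑ᵖ-δ f r pt = begin
    ∑ᵖ (λ p → f p * δ p r)                                ≡⟨ ∑ᵖ≡∑ (λ p → f p * δ p r) ⟩
    ∑ (λ v → 𝟙 (isPoint F v) * (f v * δ v r))              ≡⟨ sum-cong (allVecs F 6) flip-δ ⟩
    ∑ (λ v → δ r v * (𝟙 (isPoint F v) * f v))              ≡⟨ 𝕍.∑-δ r _ ⟩
    𝟙 (isPoint F r) * f r                                 ≡⟨ cong (λ b → 𝟙 b * f r) pt ⟩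
    1ℚ * f r                                              ≡⟨ ℚₚ.*-identityˡ (f r) ⟩
    f r                                                   ∎
    where
    flip-δ : ∀ v → 𝟙 (isPoint F v) * (f v * δ v r) ≡ δ r v * (𝟙 (isPoint F v) * f v)
    flip-δ v = trans (cong (λ d → 𝟙 (isPoint F v) * (f v * d)) (𝟙-⇔ (v ≟ⱽ r) (r ≟ⱽ v) sym sym))
      (solve 3 (λ a b d → a :* (b :* d) := d :* (a :* b)) refl (𝟙 (isPoint F v)) (f v) (δ r v))

  Homogeneous : (Vec K 6 → ℚ) → Set
  Homogeneous f = ∀ {c} v → c ≢ 0ᶠ → f (c • v) ≡ f v

  zero?-Q-homogeneous : Homogeneous (λ v → zero? (Q v))
  zero?-Q-homogeneous {c} v c≢0 = trans (cong zero? (Q-• c v)) (zero?-scale (Q v) (*ᶠ-nonzero c≢0 c≢0))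

  zero?-B-homogeneous : ∀ u → Homogeneous (λ v → zero? (B v u))
  zero?-B-homogeneous u {c} v c≢0 = trans (cong zero? (trans (B-sym (c • v) u) (trans (B-•ʳ u c v) (cong (c *ᶠ_) (B-sym u v)))))
    (zero?-scale (B v u) c≢0)

  -- The points are exactly the normalised singular vectors, and each stands for q - 1 vectors.
  ∑-singular : ∀ f → Homogeneous f → ∑ (λ v → zero? (Q v) * f v) ≡ f 𝟎 + (q̂ - 1ℚ) * ∑ᵖ f
  ∑-singular f hom = begin
    ∑ (λ v → zero? (Q v) * f v)
      ≡⟨ ∑-projective _ (λ v c≢0 → cong₂ _*_ (zero?-Q-homogeneous v c≢0) (hom v c≢0)) ⟩
    zero? (Q 𝟎) * f 𝟎 + (q̂ - 1ℚ) * ∑ (λ v → 𝟙 (isNormalised F v) * (zero? (Q v) * f v))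
      ≡⟨ cong₂ (λ x y → x + (q̂ - 1ℚ) * y)
           (trans (cong (_* f 𝟎) (zero?-yes Q-𝟎)) (ℚₚ.*-identityˡ (f 𝟎)))
           (trans (sum-cong (allVecs F 6) (λ v → trans (sym (ℚₚ.*-assoc (𝟙 (isNormalised F v)) (zero? (Q v)) (f v)))
              (cong (_* f v) (sym (𝟙-∧ (isNormalised F v) (isZero F (Q v))))))) (sym (∑ᵖ≡∑ f))) ⟩
    f 𝟎 + (q̂ - 1ℚ) * ∑ᵖ f     ∎

  q̂^-nonzero : ∀ n → q̂^ n ≢ 0ℚ
  q̂^-nonzero zero    ()
  q̂^-nonzero (suc n) = *-nonzero q̂≢0 (q̂^-nonzero n)

  pow : ∀ {n} → ℕ → Polynomial n → Polynomial n
  pow zero    x = con 1ℚ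
  pow (suc k) x = x :* pow k x

  Q-⊕ : ∀ u v → Q (u ⊕ v) ≡ Q u +ᶠ B u v +ᶠ Q v
  Q-⊕ u v = begin
    Q (u ⊕ v)                                   ≡⟨ cong (λ z → Q (u ⊕ z)) (sym (•-identity v)) ⟩
    Q (u ⊕ 1ᶠ • v)                              ≡⟨ Q-⊕• u 1ᶠ v ⟩
    Q u +ᶠ 1ᶠ *ᶠ B u v +ᶠ 1ᶠ *ᶠ 1ᶠ *ᶠ Q v
      ≡⟨ 𝔽.solve 3 (λ x y z → x 𝔽.:+ 𝔽.con 1 𝔽.:* y 𝔽.:+ 𝔽.con 1 𝔽.:* 𝔽.con 1 𝔽.:* z 𝔽.:= x 𝔽.:+ y 𝔽.:+ z) refl (Q u) (B u v) (Q v) ⟩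
    Q u +ᶠ B u v +ᶠ Q v                         ∎

  module _ (P : Plane) where
    open Plane P

    ω-homogeneous : Homogeneous ω
    ω-homogeneous {c} v c≢0 with inverse c c≢0
    ... | c⁻¹ , cc⁻¹≡1 = 𝟙-⇔ (span? (c • v)) (span? v)
      (λ { (a , eq) → c⁻¹ • a , trans (m-• c⁻¹ a) (trans (cong (c⁻¹ •_) eq) (scale-inverse (trans (*ᶠ-comm c⁻¹ c) cc⁻¹≡1) v)) })
      (λ { (a , eq) → c • a , trans (m-• c a) (cong (c •_) eq) })

    ∑-plane : ∀ f → Homogeneous f → ∑ (λ a → f (m a)) ≡ f 𝟎 + (q̂ - 1ℚ) * ∑ᵖ (λ p → ω p * f p)
    ∑-plane f hom = begin
      ∑ (λ a → f (m a))                       ≡⟨ ∑-span f ⟩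
      -- Vectors of the plane are singular, so a factor `zero? (Q v)` may be inserted; this gives
      -- the form of `∑-singular`.
      ∑ (λ v → ω v * f v)                     ≡⟨ sum-cong (allVecs F 6) singular ⟩
      ∑ (λ v → zero? (Q v) * (ω v * f v))     ≡⟨ ∑-singular (λ v → ω v * f v) (λ v c≢0 → cong₂ _*_ (ω-homogeneous v c≢0) (hom v c≢0)) ⟩
      ω 𝟎 * f 𝟎 + (q̂ - 1ℚ) * ∑ᵖ (λ p → ω p * f p)
        ≡⟨ cong (_+ (q̂ - 1ℚ) * ∑ᵖ (λ p → ω p * f p)) (trans (cong (_* f 𝟎) (𝟙-yes (span? 𝟎) (𝟎 , m-𝟎))) (ℚₚ.*-identityˡ (f 𝟎))) ⟩
      f 𝟎 + (q̂ - 1ℚ) * ∑ᵖ (λ p → ω p * f p)  ∎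
      where
      singular : ∀ v → ω v * f v ≡ zero? (Q v) * (ω v * f v)
      singular v with span? v
      ... | yes (a , refl) = trans (sym (ℚₚ.*-identityˡ (1ℚ * f v))) (cong (_* (1ℚ * f v)) (sym (zero?-yes (m-singular a))))
      ... | no _ = solve 2 (λ z x → con 0ℚ :* x := z :* (con 0ℚ :* x)) refl (zero? (Q v)) (f v)

    -- Averaging over the translates by vectors of the plane.
    count-singular : ∑ (λ v → zero? (Q v)) ≡ q̂^ 5 + q̂^ 3 - q̂^ 2
    count-singular = *-cancelˡ (q̂^ 3) (q̂^-nonzero 3) (begin
      q̂^ 3 * S                                               ≡⟨ ℚₚ.*-comm (q̂^ 3) S ⟩
      S * q̂^ 3                                               ≡⟨ sym (trans (sum-const (allVecs F 3) S) (cong (S *_) (card-vectors 3))) ⟩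
      ∑ {3} (λ _ → S)                                        ≡⟨ sum-cong (allVecs F 3) (λ a → ∑-translate 1ᶠ (m a) _) ⟩
      ∑ {3} (λ a → ∑ (λ v → zero? (Q (v ⊕ 1ᶠ • m a))))       ≡⟨ sum-swap (allVecs F 3) (allVecs F 6) _ ⟩
      ∑ (λ v → ∑ (λ a → zero? (Q (v ⊕ 1ᶠ • m a))))
        ≡⟨ sum-cong (allVecs F 6) (λ v → trans (sum-cong (allVecs F 3) (λ a → cong zero? (shift v a)))
             (count-affine-perp (Q v) v (λ { (a , refl) → m-singular a }))) ⟩
      ∑ (λ v → q̂^ 2 + (q̂^ 3 - q̂^ 2) * ω v)                   ≡⟨ sum-+ (allVecs F 6) _ _ ⟩
      ∑ {6} (λ _ → q̂^ 2) + ∑ (λ v → (q̂^ 3 - q̂^ 2) * ω v)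
        ≡⟨ cong₂ _+_ (trans (sum-const (allVecs F 6) (q̂^ 2)) (cong (q̂^ 2 *_) (card-vectors 6)))
                     (trans (sum-* (allVecs F 6) (q̂^ 3 - q̂^ 2) ω) (cong ((q̂^ 3 - q̂^ 2) *_) card-span)) ⟩
      q̂^ 2 * q̂^ 6 + (q̂^ 3 - q̂^ 2) * q̂^ 3
        ≡⟨ solve 1 (λ q → pow 2 q :* pow 6 q :+ (pow 3 q :- pow 2 q) :* pow 3 q := pow 3 q :* (pow 5 q :+ pow 3 q :- pow 2 q)) refl q̂ ⟩
      q̂^ 3 * (q̂^ 5 + q̂^ 3 - q̂^ 2)                            ∎)
      where
      S : ℚ
      S = ∑ (λ v → zero? (Q v))
      -- `Q` is affine along the coset, as `m a` itself is singular.
      shift : ∀ v a → Q (v ⊕ 1ᶠ • m a) ≡ Q v +ᶠ B (m a) v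
      shift v a = begin
        Q (v ⊕ 1ᶠ • m a)                   ≡⟨ cong (λ z → Q (v ⊕ z)) (•-identity (m a)) ⟩
        Q (v ⊕ m a)                        ≡⟨ Q-⊕ v (m a) ⟩
        Q v +ᶠ B v (m a) +ᶠ Q (m a)        ≡⟨ cong₂ (λ x y → Q v +ᶠ x +ᶠ y) (B-sym v (m a)) (m-singular a) ⟩
        Q v +ᶠ B (m a) v +ᶠ 0ᶠ             ≡⟨ +ᶠ-identityʳ _ ⟩
        Q v +ᶠ B (m a) v                   ∎

    -- A line through r in a direction outside the hyperplane of r meets the quadric exactly once more.
    count-singular-perp : ∀ r → r ≢ 𝟎 → Q r ≡ 0ᶠ → ∑ (λ v → zero? (Q v) * zero? (B v r)) ≡ q̂^ 4 + q̂^ 3 - q̂^ 2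
    count-singular-perp r r≢0 Qr≡0 = *-cancelˡ q̂ q̂≢0 (begin
      q̂ * ∑ (λ v → zero? (Q v) * zero? (B v r))
        ≡⟨ cong (q̂ *_) (trans (sum-cong (allVecs F 6) (λ v →
             solve 2 (λ z b → z :* b := z :- (con 1ℚ :- b) :* z) refl (zero? (Q v)) (zero? (B v r)))) (sum-- (allVecs F 6) _ _)) ⟩
      q̂ * (∑ (λ v → zero? (Q v)) - X)
        ≡⟨ solve 3 (λ q n x → q :* (n :- x) := q :* n :- q :* x) refl q̂ _ X ⟩
      q̂ * ∑ (λ v → zero? (Q v)) - q̂ * X     ≡⟨ cong₂ (λ n x → q̂ * n - x) count-singular off-perp ⟩
      q̂ * (q̂^ 5 + q̂^ 3 - q̂^ 2) - (q̂^ 6 - q̂^ 5)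
        ≡⟨ solve 1 (λ q → q :* (pow 5 q :+ pow 3 q :- pow 2 q) :- (pow 6 q :- pow 5 q) := q :* (pow 4 q :+ pow 3 q :- pow 2 q)) refl q̂ ⟩
      q̂ * (q̂^ 4 + q̂^ 3 - q̂^ 2)               ∎)
      where
      -- `w` selects the vectors outside the hyperplane of `r`: inside it `Q` is constant along the
      -- direction `r`, and the one-in-q count fails.
      w : Vec K 6 → ℚ
      w v = 1ℚ - zero? (B v r)
      X : ℚ
      X = ∑ (λ v → w v * zero? (Q v))
      B-shift : ∀ y t → B (y ⊕ t • r) r ≡ B y r
      B-shift y t = begin
        B (y ⊕ t • r) r                   ≡⟨ B-linearˡ y t r r ⟩
        B y r +ᶠ t *ᶠ B r r               ≡⟨ cong (λ z → B y r +ᶠ t *ᶠ z) (trans (B-self r) (cong₂ _+ᶠ_ Qr≡0 Qr≡0)) ⟩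
        B y r +ᶠ t *ᶠ (0ᶠ +ᶠ 0ᶠ)          ≡⟨ 𝔽.solve 2 (λ x t → x 𝔽.:+ t 𝔽.:* (𝔽.con 0 𝔽.:+ 𝔽.con 0) 𝔽.:= x) refl (B y r) t ⟩
        B y r                             ∎
      Q-shift : ∀ y t → Q (y ⊕ t • r) ≡ Q y +ᶠ t *ᶠ B y r
      Q-shift y t = begin
        Q (y ⊕ t • r)                                  ≡⟨ Q-⊕• y t r ⟩
        Q y +ᶠ t *ᶠ B y r +ᶠ t *ᶠ t *ᶠ Q r             ≡⟨ cong (λ z → Q y +ᶠ t *ᶠ B y r +ᶠ t *ᶠ t *ᶠ z) Qr≡0 ⟩
        Q y +ᶠ t *ᶠ B y r +ᶠ t *ᶠ t *ᶠ 0ᶠ              ≡⟨ 𝔽.solve 3 (λ x y t → x 𝔽.:+ t 𝔽.:* y 𝔽.:+ t 𝔽.:* t 𝔽.:* 𝔽.con 0 𝔽.:= x 𝔽.:+ t 𝔽.:* y) refl (Q y) (B y r) t ⟩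
        Q y +ᶠ t *ᶠ B y r                              ∎
      off-perp : q̂ * X ≡ q̂^ 6 - q̂^ 5
      off-perp = trans
        (count-zeros-on w Q r (λ y t → cong (λ z → 1ℚ - zero? z) (B-shift y t)) (λ y → B y r) Q-shift
          (λ y Byr≡0 → cong (λ z → 1ℚ - z) (zero?-yes Byr≡0)))
        (trans (sum-- (allVecs F 6) _ _) (cong₂ _-_ (card-vectors 6)
          (trans (sum-cong (allVecs F 6) (λ v → cong zero? (trans (B-sym v r) (sym (+ᶠ-identityˡ (B r v)))))) (count-linear r r≢0))))

    -- The quotient of q⁴ + q³ - q² - 1 by q - 1. The final 1 counts `r` itself, leaving q(q + 1)²
    -- collinear points.
    points-perp : ∀ r → r ≢ 𝟎 → Q r ≡ 0ᶠ → ∑ᵖ (λ p → zero? (B p r)) ≡ q̂ * (q̂ + 1ℚ) * (q̂ + 1ℚ) + 1ℚ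
    points-perp r r≢0 Qr≡0 = *-cancelˡ (q̂ - 1ℚ) q̂-1≢0 (begin
      (q̂ - 1ℚ) * X                           ≡⟨ solve 2 (λ q x → (q :- con 1ℚ) :* x := (con 1ℚ :+ (q :- con 1ℚ) :* x) :- con 1ℚ) refl q̂ X ⟩
      (1ℚ + (q̂ - 1ℚ) * X) - 1ℚ               ≡⟨ cong (_- 1ℚ) (cong (_+ (q̂ - 1ℚ) * X) (sym (zero?-yes (B-𝟎ˡ r)))) ⟩
      (zero? (B 𝟎 r) + (q̂ - 1ℚ) * X) - 1ℚ    ≡⟨ cong (_- 1ℚ) (sym (∑-singular _ (zero?-B-homogeneous r))) ⟩
      ∑ (λ v → zero? (Q v) * zero? (B v r)) - 1ℚ   ≡⟨ cong (_- 1ℚ) (count-singular-perp r r≢0 Qr≡0) ⟩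
      (q̂^ 4 + q̂^ 3 - q̂^ 2) - 1ℚ
        ≡⟨ solve 1 (λ q → (pow 4 q :+ pow 3 q :- pow 2 q) :- con 1ℚ :=
             (q :- con 1ℚ) :* (q :* (q :+ con 1ℚ) :* (q :+ con 1ℚ) :+ con 1ℚ)) refl q̂ ⟩
      (q̂ - 1ℚ) * (q̂ * (q̂ + 1ℚ) * (q̂ + 1ℚ) + 1ℚ)      ∎)
      where
      X : ℚ
      X = ∑ᵖ (λ p → zero? (B p r))

    -- The plane has q² vectors orthogonal to `r`, hence (q² - 1)/(q - 1) points: those of a line.
    plane-points-perp : ∀ r → ¬ (∃ λ a → m a ≡ r) → ∑ᵖ (λ p → ω p * zero? (B p r)) ≡ q̂ + 1ℚ
    plane-points-perp r r∉ = *-cancelˡ (q̂ - 1ℚ) q̂-1≢0 (begin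
      (q̂ - 1ℚ) * X                           ≡⟨ solve 2 (λ q x → (q :- con 1ℚ) :* x := (con 1ℚ :+ (q :- con 1ℚ) :* x) :- con 1ℚ) refl q̂ X ⟩
      (1ℚ + (q̂ - 1ℚ) * X) - 1ℚ               ≡⟨ cong (_- 1ℚ) (cong (_+ (q̂ - 1ℚ) * X) (sym (zero?-yes (B-𝟎ˡ r)))) ⟩
      (zero? (B 𝟎 r) + (q̂ - 1ℚ) * X) - 1ℚ    ≡⟨ cong (_- 1ℚ) (sym (∑-plane _ (zero?-B-homogeneous r))) ⟩
      ∑ (λ a → zero? (B (m a) r)) - 1ℚ       ≡⟨ cong (_- 1ℚ) (count-plane-perp r) ⟩
      (q̂^ 2 + (q̂^ 3 - q̂^ 2) * ω r) - 1ℚ      ≡⟨ cong (λ z → (q̂^ 2 + (q̂^ 3 - q̂^ 2) * z) - 1ℚ) (𝟙-no (span? r) r∉) ⟩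
      (q̂^ 2 + (q̂^ 3 - q̂^ 2) * 0ℚ) - 1ℚ
        ≡⟨ solve 1 (λ q → (pow 2 q :+ (pow 3 q :- pow 2 q) :* con 0ℚ) :- con 1ℚ := (q :- con 1ℚ) :* (q :+ con 1ℚ)) refl q̂ ⟩
      (q̂ - 1ℚ) * (q̂ + 1ℚ)                    ∎)
      where
      X : ℚ
      X = ∑ᵖ (λ p → ω p * zero? (B p r))

  -- Collinearity

  -- On the line through two singular vectors `Q` takes the values l k B(p, r), so l = k = 1 already
  -- decides.
  line-singular≡perp : ∀ p r → Q p ≡ 0ᶠ → Q r ≡ 0ᶠ →
    all (λ l → all (λ k → isZero F (Q (l • p ⊕ k • r))) (elems F)) (elems F) ≡ isZero F (B p r)
  line-singular≡perp p r Qp≡0 Qr≡0 = true-⇔⇒≡ to from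
    where
    expand : ∀ l k → Q (l • p ⊕ k • r) ≡ k *ᶠ (l *ᶠ B p r)
    expand l k = begin
      Q (l • p ⊕ k • r)                                          ≡⟨ Q-⊕• (l • p) k r ⟩
      Q (l • p) +ᶠ k *ᶠ B (l • p) r +ᶠ k *ᶠ k *ᶠ Q r
        ≡⟨ cong₂ (λ x y → x +ᶠ k *ᶠ B (l • p) r +ᶠ k *ᶠ k *ᶠ y) (trans (Q-• l p) (cong (l *ᶠ l *ᶠ_) Qp≡0)) Qr≡0 ⟩
      l *ᶠ l *ᶠ 0ᶠ +ᶠ k *ᶠ B (l • p) r +ᶠ k *ᶠ k *ᶠ 0ᶠ
        ≡⟨ 𝔽.solve 3 (λ l k x → l 𝔽.:* l 𝔽.:* 𝔽.con 0 𝔽.:+ k 𝔽.:* x 𝔽.:+ k 𝔽.:* k 𝔽.:* 𝔽.con 0 𝔽.:= k 𝔽.:* x) refl l k (B (l • p) r) ⟩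
      k *ᶠ B (l • p) r                                           ≡⟨ cong (k *ᶠ_) (trans (B-sym (l • p) r) (trans (B-•ʳ r l p) (cong (l *ᶠ_) (B-sym r p)))) ⟩
      k *ᶠ (l *ᶠ B p r)                                          ∎
    to : all (λ l → all (λ k → isZero F (Q (l • p ⊕ k • r))) (elems F)) (elems F) ≡ true → isZero F (B p r) ≡ true
    to h = true-does (B p r ≟ᶠ 0ᶠ) (trans (𝔽.solve 1 (λ b → b 𝔽.:= 𝔽.con 1 𝔽.:* (𝔽.con 1 𝔽.:* b)) refl (B p r))
      (trans (sym (expand 1ᶠ 1ᶠ)) (does-true (Q (1ᶠ • p ⊕ 1ᶠ • r) ≟ᶠ 0ᶠ) (all-true⁻ _ (∈-elems 1ᶠ) (all-true⁻ _ (∈-elems 1ᶠ) h)))))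
    from : isZero F (B p r) ≡ true → all (λ l → all (λ k → isZero F (Q (l • p ⊕ k • r))) (elems F)) (elems F) ≡ true
    from h = all-true _ (elems F) λ l → all-true _ (elems F) λ k → true-does (Q (l • p ⊕ k • r) ≟ᶠ 0ᶠ)
      (trans (expand l k) (trans (cong (λ z → k *ᶠ (l *ᶠ z)) (does-true (B p r ≟ᶠ 0ᶠ) h))
        (𝔽.solve 2 (λ k l → k 𝔽.:* (l 𝔽.:* 𝔽.con 0) 𝔽.:= 𝔽.con 0) refl k l)))

  B-diagonal : ∀ p → Q p ≡ 0ᶠ → B p p ≡ 0ᶠ
  B-diagonal p Qp≡0 = trans (B-self p) (trans (cong₂ _+ᶠ_ Qp≡0 Qp≡0) (+ᶠ-identityˡ 0ᶠ))

  collinear≡ : ∀ p r → Q p ≡ 0ᶠ → Q r ≡ 0ᶠ → collinear F p r ≡ not (eqV F p r) ∧ isZero F (B p r)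
  collinear≡ p r Qp≡0 Qr≡0 = cong (not (eqV F p r) ∧_) (line-singular≡perp p r Qp≡0 Qr≡0)

  -- The equality test is absorbed, since a singular `p` has B(p, p) = 2 Q(p) = 0.
  perp≡ : ∀ p r → Q p ≡ 0ᶠ → Q r ≡ 0ᶠ → (eqV F p r ∨ collinear F p r) ≡ isZero F (B p r)
  perp≡ p r Qp≡0 Qr≡0 = trans (cong (eqV F p r ∨_) (collinear≡ p r Qp≡0 Qr≡0)) (go (p ≟ⱽ r))
    where
    go : (p≟r : Dec (p ≡ r)) → (does p≟r ∨ (not (does p≟r) ∧ isZero F (B p r))) ≡ isZero F (B p r)
    go (yes refl) = sym (true-does (B p p ≟ᶠ 0ᶠ) (B-diagonal p Qp≡0))
    go (no _)     = refl

  -- A point is orthogonal to itself but not collinear with itself; `δ` corrects the diagonal.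
  𝟙-collinear : ∀ p r → Q p ≡ 0ᶠ → Q r ≡ 0ᶠ → 𝟙 (collinear F p r) ≡ zero? (B p r) - δ p r
  𝟙-collinear p r Qp≡0 Qr≡0 = trans (cong 𝟙 (collinear≡ p r Qp≡0 Qr≡0)) (go (p ≟ⱽ r))
    where
    go : (p≟r : Dec (p ≡ r)) → 𝟙 (not (does p≟r) ∧ isZero F (B p r)) ≡ zero? (B p r) - 𝟙 (does p≟r)
    go (yes refl) = sym (cong (_- 1ℚ) (zero?-yes (B-diagonal p Qp≡0)))
    go (no _)     = sym (solve 1 (λ x → x :- con 0ℚ := x) refl (zero? (B p r)))

  -- The cross product and its kernel.

  •-distribʳ : ∀ {n} a t b (v : Vec K n) → (a +ᶠ t *ᶠ b) • v ≡ a • v ⊕ t • (b • v)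
  •-distribʳ a t b []      = refl
  •-distribʳ a t b (x ∷ v) = cong₂ _∷_
    (𝔽.solve 4 (λ a t b x → (a 𝔽.:+ t 𝔽.:* b) 𝔽.:* x 𝔽.:= a 𝔽.:* x 𝔽.:+ t 𝔽.:* (b 𝔽.:* x)) refl a t b x) (•-distribʳ a t b v)

  •-injectiveˡ : ∀ {n a b} {v : Vec K n} → v ≢ 𝟎 → a • v ≡ b • v → a ≡ b
  •-injectiveˡ {a = a} {b} {v} v≢0 eq = decidable-stable (a ≟ᶠ b) λ a≢b →
    •-nonzero (a≢b ∘ difference-zero⇒≡) v≢0 (begin
      (a +ᶠ -1ᶠ *ᶠ b) • v          ≡⟨ •-distribʳ a -1ᶠ b v ⟩
      a • v ⊕ -1ᶠ • (b • v)        ≡⟨ cong (_⊕ -1ᶠ • (b • v)) eq ⟩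
      b • v ⊕ -1ᶠ • (b • v)        ≡⟨ ⊖-inverse (b • v) ⟩
      𝟎                            ∎)

  dot : Vec K 3 → Vec K 3 → K
  dot (a₁ ∷ a₂ ∷ a₃ ∷ []) (b₁ ∷ b₂ ∷ b₃ ∷ []) = a₁ *ᶠ b₁ +ᶠ a₂ *ᶠ b₂ +ᶠ a₃ *ᶠ b₃

  cross : Vec K 3 → Vec K 3 → Vec K 3
  cross (a₁ ∷ a₂ ∷ a₃ ∷ []) (r₁ ∷ r₂ ∷ r₃ ∷ []) =
    (a₂ *ᶠ r₃ +ᶠ -1ᶠ *ᶠ (a₃ *ᶠ r₂)) ∷ (a₃ *ᶠ r₁ +ᶠ -1ᶠ *ᶠ (a₁ *ᶠ r₃)) ∷ (a₁ *ᶠ r₂ +ᶠ -1ᶠ *ᶠ (a₂ *ᶠ r₁)) ∷ []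

  vec3 : ∀ {a b c a′ b′ c′ : K} → a ≡ a′ → b ≡ b′ → c ≡ c′ →
    _≡_ {A = Vec K 3} (a ∷ b ∷ c ∷ []) (a′ ∷ b′ ∷ c′ ∷ [])
  vec3 refl refl refl = refl

  cross-linear : ∀ a c b r → cross (a ⊕ c • b) r ≡ cross a r ⊕ c • cross b r
  cross-linear (a₁ ∷ a₂ ∷ a₃ ∷ []) c (b₁ ∷ b₂ ∷ b₃ ∷ []) (r₁ ∷ r₂ ∷ r₃ ∷ []) =
    vec3 (minor a₂ a₃ b₂ b₃ r₃ r₂) (minor a₃ a₁ b₃ b₁ r₁ r₃) (minor a₁ a₂ b₁ b₂ r₂ r₁)
    where
    minor : ∀ a a′ b b′ r r′ → (a +ᶠ c *ᶠ b) *ᶠ r +ᶠ -1ᶠ *ᶠ ((a′ +ᶠ c *ᶠ b′) *ᶠ r′) ≡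
                               (a *ᶠ r +ᶠ -1ᶠ *ᶠ (a′ *ᶠ r′)) +ᶠ c *ᶠ (b *ᶠ r +ᶠ -1ᶠ *ᶠ (b′ *ᶠ r′))
    minor a a′ b b′ r r′ = 𝔽.solve 8 (λ e c a a′ b b′ r r′ →
      (a 𝔽.:+ c 𝔽.:* b) 𝔽.:* r 𝔽.:+ e 𝔽.:* ((a′ 𝔽.:+ c 𝔽.:* b′) 𝔽.:* r′) 𝔽.:=
      (a 𝔽.:* r 𝔽.:+ e 𝔽.:* (a′ 𝔽.:* r′)) 𝔽.:+ c 𝔽.:* (b 𝔽.:* r 𝔽.:+ e 𝔽.:* (b′ 𝔽.:* r′))) refl -1ᶠ c a a′ b b′ r r′

  -- The map a ↦ a × r is alternating, which is what makes its graph totally singular.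
  dot-cross : ∀ a r → dot a (cross a r) ≡ 0ᶠ
  dot-cross (a₁ ∷ a₂ ∷ a₃ ∷ []) (r₁ ∷ r₂ ∷ r₃ ∷ []) = trans
    (𝔽.solve 7 (λ e a₁ a₂ a₃ r₁ r₂ r₃ →
      a₁ 𝔽.:* (a₂ 𝔽.:* r₃ 𝔽.:+ e 𝔽.:* (a₃ 𝔽.:* r₂)) 𝔽.:+ a₂ 𝔽.:* (a₃ 𝔽.:* r₁ 𝔽.:+ e 𝔽.:* (a₁ 𝔽.:* r₃))
        𝔽.:+ a₃ 𝔽.:* (a₁ 𝔽.:* r₂ 𝔽.:+ e 𝔽.:* (a₂ 𝔽.:* r₁))
      𝔽.:= (𝔽.con 1 𝔽.:+ e) 𝔽.:* (a₁ 𝔽.:* a₂ 𝔽.:* r₃ 𝔽.:+ a₂ 𝔽.:* a₃ 𝔽.:* r₁ 𝔽.:+ a₃ 𝔽.:* a₁ 𝔽.:* r₂))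
      refl -1ᶠ a₁ a₂ a₃ r₁ r₂ r₃)
    ([1-1]*≡0 _)

  cross-multiple : ∀ c r → cross (c • r) r ≡ 𝟎
  cross-multiple c (r₁ ∷ r₂ ∷ r₃ ∷ []) = vec3 (minor r₂ r₃) (minor r₃ r₁) (minor r₁ r₂)
    where
    minor : ∀ r r′ → (c *ᶠ r) *ᶠ r′ +ᶠ -1ᶠ *ᶠ ((c *ᶠ r′) *ᶠ r) ≡ 0ᶠ
    minor r r′ = trans (𝔽.solve 4 (λ e c r r′ → (c 𝔽.:* r) 𝔽.:* r′ 𝔽.:+ e 𝔽.:* ((c 𝔽.:* r′) 𝔽.:* r) 𝔽.:=
      (𝔽.con 1 𝔽.:+ e) 𝔽.:* (c 𝔽.:* r 𝔽.:* r′)) refl -1ᶠ c r r′) ([1-1]*≡0 _)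

  -- At a nonzero coordinate of `r` the ratio of the coordinates of `a` and `r` is the multiplier,
  -- and the vanishing minors carry it to the other two. With `cross-multiple`, the kernel of a ↦ a
  -- × r is the line of `r`.
  cross-zero⇒multiple : ∀ a r → r ≢ 𝟎 → cross a r ≡ 𝟎 → ∃ λ c → c • r ≡ a
  cross-zero⇒multiple (a₁ ∷ a₂ ∷ a₃ ∷ []) (r₁ ∷ r₂ ∷ r₃ ∷ []) r≢0 eq
    with ∷-injective eq
  ... | e₁ , eq′ with ∷-injective eq′
  ... | e₂ , eq″ with ∷-injective eq″
  ... | e₃ , _ = go (r₁ ≟ᶠ 0ᶠ) (r₂ ≟ᶠ 0ᶠ) (r₃ ≟ᶠ 0ᶠ)
    where
    ratio : ∀ {a r a′ r′ r⁻¹} → r *ᶠ r⁻¹ ≡ 1ᶠ → a *ᶠ r′ ≡ a′ *ᶠ r → (a *ᶠ r⁻¹) *ᶠ r′ ≡ a′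
    ratio {a} {r} {a′} {r′} {r⁻¹} rr⁻¹≡1 eq = begin
      (a *ᶠ r⁻¹) *ᶠ r′    ≡⟨ 𝔽.solve 3 (λ a i r → a 𝔽.:* i 𝔽.:* r 𝔽.:= a 𝔽.:* r 𝔽.:* i) refl a r⁻¹ r′ ⟩
      a *ᶠ r′ *ᶠ r⁻¹      ≡⟨ cong (_*ᶠ r⁻¹) eq ⟩
      a′ *ᶠ r *ᶠ r⁻¹      ≡⟨ *ᶠ-assoc a′ r r⁻¹ ⟩
      a′ *ᶠ (r *ᶠ r⁻¹)    ≡⟨ cong (a′ *ᶠ_) rr⁻¹≡1 ⟩
      a′ *ᶠ 1ᶠ            ≡⟨ 𝔽.solve 1 (λ x → x 𝔽.:* 𝔽.con 1 𝔽.:= x) refl a′ ⟩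
      a′                  ∎
    m₁ = difference-zero⇒≡ e₁
    m₂ = difference-zero⇒≡ e₂
    m₃ = difference-zero⇒≡ e₃
    go : Dec (r₁ ≡ 0ᶠ) → Dec (r₂ ≡ 0ᶠ) → Dec (r₃ ≡ 0ᶠ) → ∃ λ c → c • (r₁ ∷ r₂ ∷ r₃ ∷ []) ≡ a₁ ∷ a₂ ∷ a₃ ∷ []
    go (no r₁≢0) _ _ with inverse r₁ r₁≢0
    ... | i , inv = a₁ *ᶠ i , vec3 (ratio inv refl) (ratio inv m₃) (ratio inv (sym m₂))
    go (yes _) (no r₂≢0) _ with inverse r₂ r₂≢0
    ... | i , inv = a₂ *ᶠ i , vec3 (ratio inv (sym m₃)) (ratio inv refl) (ratio inv m₁)
    go (yes _) (yes _) (no r₃≢0) with inverse r₃ r₃≢0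
    ... | i , inv = a₃ *ᶠ i , vec3 (ratio inv m₂) (ratio inv (sym m₁)) (ratio inv refl)
    go (yes p₁) (yes p₂) (yes p₃) = ⊥-elim (r≢0 (vec3 p₁ p₂ p₃))

  -- One plane as the dual of a disjoint one, and graph planes.

  module _ (P₁ P₂ : Plane)
           (disjoint : ∀ {v} → (∃ λ a → Plane.m P₁ a ≡ v) → (∃ λ a → Plane.m P₂ a ≡ v) → v ≡ 𝟎) where
    private
      module P₁ = Plane P₁
      module P₂ = Plane P₂
      m₁ m₂ : Vec K 3 → Vec K 6
      m₁ = P₁.m
      m₂ = P₂.m
      e₁ e₂ e₃ : Vec K 3
      e₁ = 1ᶠ ∷ 0ᶠ ∷ 0ᶠ ∷ []
      e₂ = 0ᶠ ∷ 1ᶠ ∷ 0ᶠ ∷ []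
      e₃ = 0ᶠ ∷ 0ᶠ ∷ 1ᶠ ∷ []

    -- The functional a ↦ B (m₁ a) v on the first plane, recorded by its values on the standard
    -- basis, so that K³ serves as its own dual.
    pairing : Vec K 6 → Vec K 3
    pairing v = B (m₁ e₁) v ∷ B (m₁ e₂) v ∷ B (m₁ e₃) v ∷ []

    pairing-linear : ∀ v c w → pairing (v ⊕ c • w) ≡ pairing v ⊕ c • pairing w
    pairing-linear v c w = vec3 (B-linearʳ (m₁ e₁) v c w) (B-linearʳ (m₁ e₂) v c w) (B-linearʳ (m₁ e₃) v c w)

    dot-pairing : ∀ a v → B (m₁ a) v ≡ dot a (pairing v)
    dot-pairing a@(a₁ ∷ a₂ ∷ a₃ ∷ []) v = begin
      B (m₁ a) v
        ≡⟨ cong (λ a → B (m₁ a) v) (vec3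
             (𝔽.solve 3 (λ x y z → x 𝔽.:= 𝔽.con 0 𝔽.:+ x 𝔽.:* 𝔽.con 1 𝔽.:+ y 𝔽.:* 𝔽.con 0 𝔽.:+ z 𝔽.:* 𝔽.con 0) refl a₁ a₂ a₃)
             (𝔽.solve 3 (λ x y z → y 𝔽.:= 𝔽.con 0 𝔽.:+ x 𝔽.:* 𝔽.con 0 𝔽.:+ y 𝔽.:* 𝔽.con 1 𝔽.:+ z 𝔽.:* 𝔽.con 0) refl a₁ a₂ a₃)
             (𝔽.solve 3 (λ x y z → z 𝔽.:= 𝔽.con 0 𝔽.:+ x 𝔽.:* 𝔽.con 0 𝔽.:+ y 𝔽.:* 𝔽.con 0 𝔽.:+ z 𝔽.:* 𝔽.con 1) refl a₁ a₂ a₃)) ⟩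
      B (m₁ (𝟎 ⊕ a₁ • e₁ ⊕ a₂ • e₂ ⊕ a₃ • e₃)) v                        ≡⟨ step (𝟎 ⊕ a₁ • e₁ ⊕ a₂ • e₂) a₃ e₃ ⟩
      B (m₁ (𝟎 ⊕ a₁ • e₁ ⊕ a₂ • e₂)) v +ᶠ a₃ *ᶠ B (m₁ e₃) v
        ≡⟨ cong (_+ᶠ a₃ *ᶠ B (m₁ e₃) v) (trans (step (𝟎 ⊕ a₁ • e₁) a₂ e₂) (cong (_+ᶠ a₂ *ᶠ B (m₁ e₂) v) (trans (step 𝟎 a₁ e₁)
             (trans (cong (_+ᶠ a₁ *ᶠ B (m₁ e₁) v) (trans (cong (λ z → B z v) P₁.m-𝟎) (B-𝟎ˡ v))) (+ᶠ-identityˡ _))))) ⟩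
      dot a (pairing v)                                                  ∎
      where
      step : ∀ x c y → B (m₁ (x ⊕ c • y)) v ≡ B (m₁ x) v +ᶠ c *ᶠ B (m₁ y) v
      step x c y = trans (cong (λ z → B z v) (P₁.m-linear x c y)) (B-linearˡ (m₁ x) c (m₁ y) v)

    dot-𝟎 : ∀ a → dot a 𝟎 ≡ 0ᶠ
    dot-𝟎 (a₁ ∷ a₂ ∷ a₃ ∷ []) = 𝔽.solve 3 (λ x y z → x 𝔽.:* 𝔽.con 0 𝔽.:+ y 𝔽.:* 𝔽.con 0 𝔽.:+ z 𝔽.:* 𝔽.con 0 𝔽.:= 𝔽.con 0) refl a₁ a₂ a₃

    -- A vector of the second plane orthogonal to the whole first plane lies in the first plane,
    -- which is its own orthogonal complement; and the two planes meet only in zero.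
    pairing-injective : ∀ {b b′} → pairing (m₂ b) ≡ pairing (m₂ b′) → b ≡ b′
    pairing-injective {b} {b′} eq = ⊖-zero⇒≡ b b′ (P₂.m-kernel d
      (disjoint (P₁.perp⇒span (m₂ d) λ a → trans (dot-pairing a (m₂ d)) (trans (cong (dot a) pairing-d) (dot-𝟎 a)))
                (d , refl)))
      where
      d : Vec K 3
      d = b ⊕ -1ᶠ • b′
      pairing-d : pairing (m₂ d) ≡ 𝟎
      pairing-d = begin
        pairing (m₂ d)                                   ≡⟨ cong pairing (P₂.m-linear b -1ᶠ b′) ⟩
        pairing (m₂ b ⊕ -1ᶠ • m₂ b′)                     ≡⟨ pairing-linear (m₂ b) -1ᶠ (m₂ b′) ⟩
        pairing (m₂ b) ⊕ -1ᶠ • pairing (m₂ b′)           ≡⟨ cong (_⊕ -1ᶠ • pairing (m₂ b′)) eq ⟩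
        pairing (m₂ b′) ⊕ -1ᶠ • pairing (m₂ b′)          ≡⟨ ⊖-inverse (pairing (m₂ b′)) ⟩
        𝟎                                                ∎

    -- Abstract, since unfolding the exhaustive search makes conversion checking explode.
    abstract
      dual-surjective : ∀ c → ∃ λ b → pairing (m₂ b) ≡ c
      dual-surjective = injective⇒surjective (vectors 3) (pairing ∘ m₂) pairing-injective

    -- Inverse of the pairing: `m₂ (dual c)` is the vector of the second plane that induces the
    -- functional `c` on the first.
    dual : Vec K 3 → Vec K 3
    dual c = proj₁ (dual-surjective c)

    pairing-dual : ∀ c → pairing (m₂ (dual c)) ≡ c
    pairing-dual c = proj₂ (dual-surjective c)

    dual-linear : ∀ a c b → dual (a ⊕ c • b) ≡ dual a ⊕ c • dual b
    dual-linear a c b = pairing-injective (begin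
      pairing (m₂ (dual (a ⊕ c • b)))                        ≡⟨ pairing-dual (a ⊕ c • b) ⟩
      a ⊕ c • b                                              ≡⟨ cong₂ (λ x y → x ⊕ c • y) (sym (pairing-dual a)) (sym (pairing-dual b)) ⟩
      pairing (m₂ (dual a)) ⊕ c • pairing (m₂ (dual b))      ≡⟨ sym (pairing-linear (m₂ (dual a)) c (m₂ (dual b))) ⟩
      pairing (m₂ (dual a) ⊕ c • m₂ (dual b))                ≡⟨ cong pairing (sym (P₂.m-linear (dual a) c (dual b))) ⟩
      pairing (m₂ (dual a ⊕ c • dual b))                     ∎)

    dual-𝟎 : dual 𝟎 ≡ 𝟎
    dual-𝟎 = pairing-injective (trans (pairing-dual 𝟎) (sym (trans (cong pairing P₂.m-𝟎)
      (vec3 (B-𝟎ʳ (m₁ e₁)) (B-𝟎ʳ (m₁ e₂)) (B-𝟎ʳ (m₁ e₃))))))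

    summand : ∀ {u v w : Vec K 6} → u ⊕ v ≡ w → u ≡ w ⊕ -1ᶠ • v
    summand {u} {v} refl = begin
      u                          ≡⟨ sym (⊕-•-cancel 1-1 u v) ⟩
      u ⊕ 1ᶠ • v ⊕ -1ᶠ • v       ≡⟨ cong (λ z → u ⊕ z ⊕ -1ᶠ • v) (•-identity v) ⟩
      u ⊕ v ⊕ -1ᶠ • v            ∎

    -- The graph of the alternating map a ↦ a × r from P₁ to P₂ ≅ P₁*.
    graph : Vec K 3 → Vec K 3 → Vec K 6
    graph r a = m₁ a ⊕ m₂ (dual (cross a r))

    -- The component in the second plane is then a difference of vectors of the first, hence zero.
    graph∈P₁⇒cross≡0 : ∀ r a → (∃ λ b → m₁ b ≡ graph r a) → cross a r ≡ 𝟎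
    graph∈P₁⇒cross≡0 r a (b , eq) = begin
      cross a r                            ≡⟨ sym (pairing-dual (cross a r)) ⟩
      pairing (m₂ (dual (cross a r)))      ≡⟨ cong pairing φ≡0 ⟩
      pairing 𝟎                            ≡⟨ vec3 (B-𝟎ʳ (m₁ e₁)) (B-𝟎ʳ (m₁ e₂)) (B-𝟎ʳ (m₁ e₃)) ⟩
      𝟎                                    ∎
      where
      φ : Vec K 6
      φ = m₂ (dual (cross a r))
      φ≡ : φ ≡ m₁ (b ⊕ -1ᶠ • a)
      φ≡ = trans (summand (trans (⊕-comm φ (m₁ a)) (sym eq))) (sym (P₁.m-linear b -1ᶠ a))
      φ≡0 : φ ≡ 𝟎
      φ≡0 = disjoint (b ⊕ -1ᶠ • a , sym φ≡) (dual (cross a r) , refl)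

    graph∈P₂⇒≡0 : ∀ r a → (∃ λ b → m₂ b ≡ graph r a) → a ≡ 𝟎
    graph∈P₂⇒≡0 r a (b , eq) = P₁.m-kernel a (disjoint (a , refl)
      (b ⊕ -1ᶠ • dual (cross a r) , trans (P₂.m-linear b -1ᶠ _) (sym (summand (sym eq)))))

    graph-plane : Vec K 3 → Plane
    graph-plane r = record
      { m = graph r
      ; m-linear = λ a c b → begin
          m₁ (a ⊕ c • b) ⊕ m₂ (dual (cross (a ⊕ c • b) r))
            ≡⟨ cong₂ _⊕_ (P₁.m-linear a c b) (trans (cong m₂ (trans (cong dual (cross-linear a c b r)) (dual-linear _ c _))) (P₂.m-linear _ c _)) ⟩
          (m₁ a ⊕ c • m₁ b) ⊕ (m₂ (dual (cross a r)) ⊕ c • m₂ (dual (cross b r)))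
            ≡⟨ ⊕-interchange c _ _ _ _ ⟩
          graph r a ⊕ c • graph r b ∎
      ; m-kernel = λ a eq → graph∈P₂⇒≡0 r a (𝟎 , trans P₂.m-𝟎 (sym eq))
      -- The polar term is a · (a × r) = 0, and both summands are singular.
      ; m-singular = λ a → begin
          Q (m₁ a ⊕ m₂ (dual (cross a r)))       ≡⟨ Q-⊕ (m₁ a) _ ⟩
          Q (m₁ a) +ᶠ B (m₁ a) (m₂ (dual (cross a r))) +ᶠ Q (m₂ (dual (cross a r)))
            ≡⟨ cong₂ _+ᶠ_ (cong₂ _+ᶠ_ (P₁.m-singular a)
                 (trans (dot-pairing a _) (trans (cong (dot a) (pairing-dual (cross a r))) (dot-cross a r)))) (P₂.m-singular _) ⟩
          0ᶠ +ᶠ 0ᶠ +ᶠ 0ᶠ                         ≡⟨ trans (+ᶠ-identityʳ _) (+ᶠ-identityʳ 0ᶠ) ⟩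
          0ᶠ                                     ∎
      }

    graph-multiple : ∀ r c → graph r (c • r) ≡ c • m₁ r
    graph-multiple r c = begin
      m₁ (c • r) ⊕ m₂ (dual (cross (c • r) r))   ≡⟨ cong₂ _⊕_ (P₁.m-• c r) (trans (cong (m₂ ∘ dual) (cross-multiple c r)) (trans (cong m₂ dual-𝟎) P₂.m-𝟎)) ⟩
      c • m₁ r ⊕ 𝟎                               ≡⟨ ⊕-identityʳ _ ⟩
      c • m₁ r                                   ∎

    -- `H` stands for the defect. The properties required of it are symmetric in the two planes, so
    -- the result applies to either of them.
    module _ (H : Vec K 6 → ℚ) (hom : Homogeneous H) (C : ℚ) (∑-H : ∀ P → ∑ (λ a → H (Plane.m P a)) ≡ C)
             (outside-zero : ∀ v → v ≢ 𝟎 → Q v ≡ 0ᶠ →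
               ¬ (∃ λ a → m₁ a ≡ v) → ¬ (∃ λ a → m₂ a ≡ v) → H v ≡ 0ℚ) where

      private
        -- A vector of the graph that is not a multiple of `m₁ r` lies in neither plane, so `H`
        -- vanishes there. The nonzero multiples all carry the value at `m₁ r`.
        ∑-graph : ∀ r → r ≢ 𝟎 → C ≡ H 𝟎 + (q̂ - 1ℚ) * H (m₁ r)
        ∑-graph r r≢0 = begin
          C                                          ≡⟨ sym (∑-H (graph-plane r)) ⟩
          ∑ (λ a → H (graph r a))                    ≡⟨ ∑-supported (λ a → H (graph r a)) off-line ⟩
          𝕂.∑ (λ c → H (graph r (c • r)))            ≡⟨ sum-cong (elems F) (λ c → cong H (graph-multiple r c)) ⟩
          𝕂.∑ (λ c → H (c • m₁ r))                   ≡⟨ 𝕂.∑-constant-off 0ᶠ (λ c → H (c • m₁ r)) (H (m₁ r)) (λ c c≢0 → hom (m₁ r) c≢0) ⟩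
          H (0ᶠ • m₁ r) + (q̂ - 1ℚ) * H (m₁ r)        ≡⟨ cong (λ z → H z + (q̂ - 1ℚ) * H (m₁ r)) (•-zeroˡ (m₁ r)) ⟩
          H 𝟎 + (q̂ - 1ℚ) * H (m₁ r)                  ∎
          where
          open Injection scalars (vectors 3) (_• r) (•-injectiveˡ r≢0)
          off-line : ∀ a → ¬ (∃ λ c → c • r ≡ a) → H (graph r a) ≡ 0ℚ
          off-line a a∉ = outside-zero (graph r a)
            (λ eq → ∉P₁ (𝟎 , trans P₁.m-𝟎 (sym eq)))
            (Plane.m-singular (graph-plane r) a)
            ∉P₁
            (λ a∈ → a∉ (0ᶠ , trans (•-zeroˡ r) (sym (graph∈P₂⇒≡0 r a a∈))))
            where
            ∉P₁ : ¬ (∃ λ b → m₁ b ≡ graph r a)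
            ∉P₁ b∈ = a∉ (cross-zero⇒multiple a r r≢0 (graph∈P₁⇒cross≡0 r a b∈))

      -- By `∑-graph` all nonzero vectors of the plane share one value D, so C = H(0) + (q³ - 1)D as
      -- well as C = H(0) + (q - 1)D. Subtracting gives (q³ - q)D = 0, whatever C and H(0) are.
      zero-on-plane : ∀ r → r ≢ 𝟎 → H (m₁ r) ≡ 0ℚ
      zero-on-plane r r≢0 = *-cancelˡ (q̂ * (q̂ - 1ℚ) * (q̂ + 1ℚ))
        (*-nonzero (*-nonzero q̂≢0 q̂-1≢0) q̂+1≢0) (begin
          q̂ * (q̂ - 1ℚ) * (q̂ + 1ℚ) * D
            ≡⟨ solve 3 (λ q d h → q :* (q :- con 1ℚ) :* (q :+ con 1ℚ) :* d :=
                 (h :+ (pow 3 q :- con 1ℚ) :* d) :- (h :+ (q :- con 1ℚ) :* d)) refl q̂ D (H 𝟎) ⟩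
          (H 𝟎 + (q̂^ 3 - 1ℚ) * D) - (H 𝟎 + (q̂ - 1ℚ) * D)   ≡⟨ cong₂ _-_ (sym ∑-P₁) (sym (∑-graph r r≢0)) ⟩
          C - C                                             ≡⟨ ℚₚ.+-inverseʳ C ⟩
          0ℚ                                                ≡⟨ sym (ℚₚ.*-zeroʳ (q̂ * (q̂ - 1ℚ) * (q̂ + 1ℚ))) ⟩
          q̂ * (q̂ - 1ℚ) * (q̂ + 1ℚ) * 0ℚ                      ∎)
        where
        D : ℚ
        D = H (m₁ r)
        constant : ∀ b → b ≢ 𝟎 → H (m₁ b) ≡ D
        constant b b≢0 = *-cancelˡ (q̂ - 1ℚ) q̂-1≢0 (begin
          (q̂ - 1ℚ) * H (m₁ b)                    ≡⟨ solve 2 (λ h x → x := (h :+ x) :- h) refl (H 𝟎) ((q̂ - 1ℚ) * H (m₁ b)) ⟩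
          (H 𝟎 + (q̂ - 1ℚ) * H (m₁ b)) - H 𝟎      ≡⟨ cong (_- H 𝟎) (trans (sym (∑-graph b b≢0)) (∑-graph r r≢0)) ⟩
          (H 𝟎 + (q̂ - 1ℚ) * D) - H 𝟎             ≡⟨ solve 2 (λ h x → (h :+ x) :- h := x) refl (H 𝟎) ((q̂ - 1ℚ) * D) ⟩
          (q̂ - 1ℚ) * D                           ∎)
        ∑-P₁ : C ≡ H 𝟎 + (q̂^ 3 - 1ℚ) * D
        ∑-P₁ = begin
          C                                      ≡⟨ sym (∑-H P₁) ⟩
          ∑ (λ a → H (m₁ a))                     ≡⟨ 𝕍.∑-constant-off 𝟎 (λ a → H (m₁ a)) D constant ⟩
          H (m₁ 𝟎) + (𝕍.card {3} - 1ℚ) * D       ≡⟨ cong₂ (λ x y → H x + (y - 1ℚ) * D) P₁.m-𝟎 (card-vectors 3) ⟩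
          H 𝟎 + (q̂^ 3 - 1ℚ) * D                  ∎

  -- Generators as parametrised planes.

  combination : Vec K 6 → Vec K 6 → Vec K 6 → Vec K 3 → Vec K 6
  combination u v w (a ∷ b ∷ c ∷ []) = a • u ⊕ b • v ⊕ c • w

  combination-linear : ∀ u v w a c b →
    combination u v w (a ⊕ c • b) ≡ combination u v w a ⊕ c • combination u v w b
  combination-linear u v w (a₁ ∷ a₂ ∷ a₃ ∷ []) c (b₁ ∷ b₂ ∷ b₃ ∷ []) = begin
    (a₁ +ᶠ c *ᶠ b₁) • u ⊕ (a₂ +ᶠ c *ᶠ b₂) • v ⊕ (a₃ +ᶠ c *ᶠ b₃) • w
      ≡⟨ cong₂ _⊕_ (cong₂ _⊕_ (•-distribʳ a₁ c b₁ u) (•-distribʳ a₂ c b₂ v)) (•-distribʳ a₃ c b₃ w) ⟩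
    (a₁ • u ⊕ c • (b₁ • u)) ⊕ (a₂ • v ⊕ c • (b₂ • v)) ⊕ (a₃ • w ⊕ c • (b₃ • w))
      ≡⟨ cong (_⊕ (a₃ • w ⊕ c • (b₃ • w))) (⊕-interchange c (a₁ • u) (a₂ • v) (b₁ • u) (b₂ • v)) ⟩
    (a₁ • u ⊕ a₂ • v) ⊕ c • (b₁ • u ⊕ b₂ • v) ⊕ (a₃ • w ⊕ c • (b₃ • w))
      ≡⟨ ⊕-interchange c (a₁ • u ⊕ a₂ • v) (a₃ • w) (b₁ • u ⊕ b₂ • v) (b₃ • w) ⟩
    (a₁ • u ⊕ a₂ • v ⊕ a₃ • w) ⊕ c • (b₁ • u ⊕ b₂ • v ⊕ b₃ • w) ∎

  -- The comparison is made at points only, as `π` is unconstrained at other vectors.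
  Spans : Plane → PointSet F → Set
  Spans P π = ∀ p → IsPoint F p → (π p ≡ true → ∃ λ a → m a ≡ p) × ((∃ λ a → m a ≡ p) → π p ≡ true)
    where open Plane P

  generator⇒plane : ∀ π → IsGenerator F π → ∃ λ P → Spans P π
  generator⇒plane π (u , v , w , independent , singular , π⇔) =
    record
      { m = combination u v w
      ; m-linear = combination-linear u v w
      ; m-kernel = λ { (a ∷ b ∷ c ∷ []) eq → let (a≡0 , b≡0 , c≡0) = independent a b c eq in vec3 a≡0 b≡0 c≡0 }
      ; m-singular = λ { (a ∷ b ∷ c ∷ []) → singular a b c }
      } ,
    λ p pt → (λ πp → let (a , b , c , eq) = proj₁ (π⇔ p pt) πp in (a ∷ b ∷ c ∷ []) , sym eq) ,
             (λ { ((a ∷ b ∷ c ∷ []) , eq) → proj₂ (π⇔ p pt) (a , b , c , sym eq) })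

  𝟙-π≡ω : ∀ P π → Spans P π → ∀ p → IsPoint F p → 𝟙 (π p) ≡ Plane.ω P p
  𝟙-π≡ω P π spans p pt = cong 𝟙 (true-⇔⇒≡
    (λ πp → true-does (Plane.span? P p) (proj₁ (spans p pt) πp))
    (λ h → proj₂ (spans p pt) (does-true (Plane.span? P p) h)))

  span-• : ∀ P {c v} → (∃ λ a → Plane.m P a ≡ v) → ∃ λ a → Plane.m P a ≡ c • v
  span-• P {c} (a , eq) = c • a , trans (Plane.m-• P c a) (cong (c •_) eq)

  span-•⁻ : ∀ P {c v} → c ≢ 0ᶠ → (∃ λ a → Plane.m P a ≡ c • v) → ∃ λ a → Plane.m P a ≡ v
  span-•⁻ P {c} {v} c≢0 a∈ with inverse c c≢0
  ... | c⁻¹ , cc⁻¹≡1 with span-• P {c⁻¹} a∈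
  ...   | a , eq = a , trans eq (scale-inverse (trans (*ᶠ-comm c⁻¹ c) cc⁻¹≡1) v)

  singular-• : ∀ c v → Q v ≡ 0ᶠ → Q (c • v) ≡ 0ᶠ
  singular-• c v Qv≡0 = trans (Q-• c v) (trans (cong (c *ᶠ c *ᶠ_) Qv≡0) (*ᶠ-zeroʳ _))

  -- `DisjointSets` speaks of points only; a common nonzero vector is first normalised to a common
  -- point.
  disjoint-spans : ∀ {π₁ π₂} P₁ P₂ → Spans P₁ π₁ → Spans P₂ π₂ → DisjointSets F π₁ π₂ →
    ∀ {v} → (∃ λ a → Plane.m P₁ a ≡ v) → (∃ λ a → Plane.m P₂ a ≡ v) → v ≡ 𝟎
  disjoint-spans P₁ P₂ s₁ s₂ dis {v} v∈₁@(a , ma≡v) v∈₂ = decidable-stable (v ≟ⱽ 𝟎) λ v≢0 →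
    let (c , Nc , _) = normaliser v v≢0
        pt = point-intro {c • v} Nc (singular-• c v (trans (cong Q (sym ma≡v)) (Plane.m-singular P₁ a)))
    in dis (c • v) pt (proj₂ (s₁ _ pt) (span-• P₁ v∈₁) , proj₂ (s₂ _ pt) (span-• P₂ v∈₂))

  -- The defect and its sum over a plane.

  module _ (T : PointSet F) (x : ℚ) where

    perp-weight : Vec K 6 → ℚ
    perp-weight v = ∑ᵖ (λ t → 𝟙 (T t) * zero? (B v t))

    -- With `ext` in place of the characteristic function the defect becomes a homogeneous function
    -- of all vectors, which at points is the difference of the two sides of the tightness equation.
    defect : Vec K 6 → ℚ
    defect v = perp-weight v - (x * (q̂ + 1ℚ) + q̂ * q̂ * ext (𝟙 ∘ T) v)

    defect-homogeneous : Homogeneous defect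
    defect-homogeneous {c} v c≢0 = cong₂ (λ g t → g - (x * (q̂ + 1ℚ) + q̂ * q̂ * t))
      (sum-cong (points F) (λ t → cong (𝟙 (T t) *_) (zero?-B-homogeneous t v c≢0))) (ext-• (𝟙 ∘ T) v c≢0)

    -- The plane enters the sum of `perp-weight` only through |T ∩ P|, with coefficient q³ - q², and
    -- the term with the characteristic function contributes q²(q - 1)|T ∩ P|, so the two cancel.
    -- This is where the coefficient q² in the definition of tightness matters.
    ∑-defect : ∀ P → ∑ (λ a → defect (Plane.m P a)) ≡ q̂^ 2 * ∑ᵖ (𝟙 ∘ T) - q̂^ 3 * (x * (q̂ + 1ℚ))
    ∑-defect P = begin
      ∑ (λ a → defect (m a))
        ≡⟨ sum-- (allVecs F 3) (λ a → perp-weight (m a)) (λ a → k + q̂ * q̂ * τ (m a)) ⟩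
      ∑ (λ a → perp-weight (m a)) - ∑ (λ a → k + q̂ * q̂ * τ (m a))
        ≡⟨ cong₂ _-_ ∑-perp-weight (trans (sum-+ (allVecs F 3) (λ _ → k) (λ a → q̂ * q̂ * τ (m a)))
             (cong₂ _+_ (trans (sum-const (allVecs F 3) k) (cong (k *_) (card-vectors 3)))
                        (trans (sum-* (allVecs F 3) (q̂ * q̂) (λ a → τ (m a))) (cong (q̂ * q̂ *_) ∑-τ)))) ⟩
      (q̂^ 2 * ∑ᵖ (𝟙 ∘ T) + (q̂^ 3 - q̂^ 2) * Ω) - (k * q̂^ 3 + q̂ * q̂ * ((q̂ - 1ℚ) * Ω))
        ≡⟨ solve 4 (λ q t o k → (pow 2 q :* t :+ (pow 3 q :- pow 2 q) :* o) :- (k :* pow 3 q :+ q :* q :* ((q :- con 1ℚ) :* o))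
             := pow 2 q :* t :- pow 3 q :* k) refl q̂ (∑ᵖ (𝟙 ∘ T)) Ω k ⟩
      q̂^ 2 * ∑ᵖ (𝟙 ∘ T) - q̂^ 3 * k ∎
      where
      open Plane P using (m; ω)
      k Ω : ℚ
      k = x * (q̂ + 1ℚ)
      Ω = ∑ᵖ (λ t → ω t * 𝟙 (T t))
      τ : Vec K 6 → ℚ
      τ = ext (𝟙 ∘ T)
      ∑-τ : ∑ (λ a → τ (m a)) ≡ (q̂ - 1ℚ) * Ω
      ∑-τ = begin
        ∑ (λ a → τ (m a))                            ≡⟨ ∑-plane P τ (ext-• (𝟙 ∘ T)) ⟩
        τ 𝟎 + (q̂ - 1ℚ) * ∑ᵖ (λ p → ω p * τ p)        ≡⟨ cong₂ (λ y z → y + (q̂ - 1ℚ) * z) (ext-𝟎 (𝟙 ∘ T))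
             (∑ᵖ-cong (λ p pt → cong (ω p *_) (ext-normalised (𝟙 ∘ T) p (point-normalised {p} pt)))) ⟩
        0ℚ + (q̂ - 1ℚ) * Ω                            ≡⟨ ℚₚ.+-identityˡ _ ⟩
        (q̂ - 1ℚ) * Ω                                 ∎
      ∑-perp-weight : ∑ (λ a → perp-weight (m a)) ≡ q̂^ 2 * ∑ᵖ (𝟙 ∘ T) + (q̂^ 3 - q̂^ 2) * Ω
      ∑-perp-weight = begin
        ∑ (λ a → perp-weight (m a))
          ≡⟨ sum-swap (allVecs F 3) (points F) (λ a t → 𝟙 (T t) * zero? (B (m a) t)) ⟩
        ∑ᵖ (λ t → ∑ (λ a → 𝟙 (T t) * zero? (B (m a) t)))
          ≡⟨ sum-cong (points F) (λ t → trans (sum-* (allVecs F 3) (𝟙 (T t)) (λ a → zero? (B (m a) t)))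
               (trans (cong (𝟙 (T t) *_) (Plane.count-plane-perp P t))
                 (solve 4 (λ t a b w → t :* (a :+ b :* w) := a :* t :+ b :* (w :* t)) refl (𝟙 (T t)) (q̂^ 2) (q̂^ 3 - q̂^ 2) (ω t)))) ⟩
        ∑ᵖ (λ t → q̂^ 2 * 𝟙 (T t) + (q̂^ 3 - q̂^ 2) * (ω t * 𝟙 (T t)))
          ≡⟨ sum-+ (points F) (λ t → q̂^ 2 * 𝟙 (T t)) (λ t → (q̂^ 3 - q̂^ 2) * (ω t * 𝟙 (T t))) ⟩
        ∑ᵖ (λ t → q̂^ 2 * 𝟙 (T t)) + ∑ᵖ (λ t → (q̂^ 3 - q̂^ 2) * (ω t * 𝟙 (T t)))
          ≡⟨ cong₂ _+_ (sum-* (points F) (q̂^ 2) (𝟙 ∘ T)) (sum-* (points F) (q̂^ 3 - q̂^ 2) (λ t → ω t * 𝟙 (T t))) ⟩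
        q̂^ 2 * ∑ᵖ (𝟙 ∘ T) + (q̂^ 3 - q̂^ 2) * Ω ∎

    perpCount≡ : ∀ p → IsPoint F p → ℕ→ℚ (perpCount F T p) ≡ perp-weight p
    perpCount≡ p pt = begin
      ℕ→ℚ (perpCount F T p)                                      ≡⟨ sym (sum-length (filter (λ r → T? (b r)) (points F))) ⟩
      sum (filter (λ r → T? (b r)) (points F)) (λ _ → 1ℚ)        ≡⟨ sum-filter b (points F) (λ _ → 1ℚ) ⟩
      ∑ᵖ (λ r → 𝟙 (b r) * 1ℚ)                                    ≡⟨ ∑ᵖ-cong pointwise ⟩
      perp-weight p                                              ∎
      where
      b : Vec K 6 → Bool
      b r = (eqV F p r ∨ collinear F p r) ∧ T r
      pointwise : ∀ r → IsPoint F r → 𝟙 (b r) * 1ℚ ≡ 𝟙 (T r) * zero? (B p r)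
      pointwise r ptr = begin
        𝟙 (b r) * 1ℚ                        ≡⟨ ℚₚ.*-identityʳ (𝟙 (b r)) ⟩
        𝟙 (b r)                             ≡⟨ cong (λ z → 𝟙 (z ∧ T r)) (perp≡ p r (point-singular {p} pt) (point-singular {r} ptr)) ⟩
        𝟙 (isZero F (B p r) ∧ T r)          ≡⟨ 𝟙-∧ (isZero F (B p r)) (T r) ⟩
        zero? (B p r) * 𝟙 (T r)             ≡⟨ ℚₚ.*-comm (zero? (B p r)) (𝟙 (T r)) ⟩
        𝟙 (T r) * zero? (B p r)             ∎

    TightAt : Vec K 6 → Set
    TightAt p = ℕ→ℚ (perpCount F T p) ≡ x * ℕ→ℚ (q ℕ.+ 1) + ℕ→ℚ (q ℕ.* q) * χ F (T p)

    tight-rhs : ∀ p → IsPoint F p →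
      x * ℕ→ℚ (q ℕ.+ 1) + ℕ→ℚ (q ℕ.* q) * χ F (T p) ≡ x * (q̂ + 1ℚ) + q̂ * q̂ * ext (𝟙 ∘ T) p
    tight-rhs p pt = cong₂ _+_
      (cong (x *_) (trans (ℕ→ℚ-+ q 1) (cong (_+ 1ℚ) (sym q̂≡))))
      (cong₂ _*_ (trans (ℕ→ℚ-* q q) (cong₂ _*_ (sym q̂≡) (sym q̂≡)))
        (trans (χ≡𝟙 F (T p)) (sym (ext-normalised (𝟙 ∘ T) p (point-normalised {p} pt)))))

    tight⇒defect≡0 : ∀ p → IsPoint F p → TightAt p → defect p ≡ 0ℚ
    tight⇒defect≡0 p pt tight = trans
      (cong (_- (x * (q̂ + 1ℚ) + q̂ * q̂ * ext (𝟙 ∘ T) p)) (trans (sym (perpCount≡ p pt)) (trans tight (tight-rhs p pt))))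
      (ℚₚ.+-inverseʳ (x * (q̂ + 1ℚ) + q̂ * q̂ * ext (𝟙 ∘ T) p))

    defect≡0⇒tight : ∀ p → IsPoint F p → defect p ≡ 0ℚ → TightAt p
    defect≡0⇒tight p pt h = begin
      ℕ→ℚ (perpCount F T p)    ≡⟨ perpCount≡ p pt ⟩
      perp-weight p            ≡⟨ solve 2 (λ g k → g := (g :- k) :+ k) refl (perp-weight p) k ⟩
      defect p + k             ≡⟨ cong (_+ k) h ⟩
      0ℚ + k                   ≡⟨ ℚₚ.+-identityˡ k ⟩
      k                        ≡⟨ sym (tight-rhs p pt) ⟩
      x * ℕ→ℚ (q ℕ.+ 1) + ℕ→ℚ (q ℕ.* q) * χ F (T p)  ∎
      where
      k : ℚ
      k = x * (q̂ + 1ℚ) + q̂ * q̂ * ext (𝟙 ∘ T) p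

    -- Tightness compared with the matrix equation.

    module _ (π₁ π₂ : PointSet F) (P₁ P₂ : Plane) (s₁ : Spans P₁ π₁) (s₂ : Spans P₂ π₂)
             (dis : DisjointSets F π₁ π₂)
             (T-outside : ∀ p → IsPoint F p → T p ≡ true → (π₁ p ≡ false × π₂ p ≡ false)) where
      private
        module P₁ = Plane P₁
        module P₂ = Plane P₂

      q²-1 : ℕ→ℚ (q ℕ.* q ℕ.∸ 1) ≡ q̂ * q̂ - 1ℚ
      q²-1 = begin
        ℕ→ℚ (q ℕ.* q ℕ.∸ 1)                 ≡⟨ solve 1 (λ z → z := (con 1ℚ :+ z) :- con 1ℚ) refl (ℕ→ℚ (q ℕ.* q ℕ.∸ 1)) ⟩
        (1ℚ + ℕ→ℚ (q ℕ.* q ℕ.∸ 1)) - 1ℚ     ≡⟨ cong (_- 1ℚ) (sym (ℕ→ℚ-+ 1 (q ℕ.* q ℕ.∸ 1))) ⟩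
        -- The truncated subtraction is exact because q² ≥ 1.
        ℕ→ℚ (1 ℕ.+ (q ℕ.* q ℕ.∸ 1)) - 1ℚ    ≡⟨ cong (λ n → ℕ→ℚ n - 1ℚ) (ℕₚ.m+[n∸m]≡n (ℕₚ.*-mono-≤ 1≤q 1≤q)) ⟩
        ℕ→ℚ (q ℕ.* q) - 1ℚ                  ≡⟨ cong (_- 1ℚ) (trans (ℕ→ℚ-* q q) (cong₂ _*_ (sym q̂≡) (sym q̂≡))) ⟩
        q̂ * q̂ - 1ℚ                          ∎
        where
        1≤q : 1 ℕ.≤ q
        1≤q = ℕₚ.≤-trans (ℕ.s≤s ℕ.z≤n) 2≤q

      y : ℚ
      y = divQ²-1 F x

      x≡ : x ≡ (q̂ * q̂ - 1ℚ) * y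
      x≡ = trans (sym (divQ²-1-spec q F 2≤q x)) (cong (_* y) q²-1)

      column-sum : Vec K 6 → ℚ
      column-sum r = sumℚ F (outside F π₁ π₂) (λ p → (χ F (T p) - y) * χ F (collinear F p r))

      -- An identity whether or not `T` is tight: at `r` the two sides of the matrix equation differ
      -- by exactly the defect, so both implications are read off from it.
      column-sum≡ : ∀ r → IsPoint F r → π₁ r ≡ false → π₂ r ≡ false →
        column-sum r ≡ ℕ→ℚ (q ℕ.* q ℕ.∸ 1) * (χ F (T r) - y) + defect r
      column-sum≡ r ptr π₁r π₂r = begin
        column-sum r
          ≡⟨ sumℚ≡sum F (outside F π₁ π₂) (λ p → (χ F (T p) - y) * χ F (collinear F p r)) ⟩
        sum (outside F π₁ π₂) (λ p → (χ F (T p) - y) * χ F (collinear F p r))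
          ≡⟨ sum-filter (λ p → not (π₁ p ∨ π₂ p)) (points F) (λ p → (χ F (T p) - y) * χ F (collinear F p r)) ⟩
        ∑ᵖ (λ p → 𝟙 (not (π₁ p ∨ π₂ p)) * ((χ F (T p) - y) * χ F (collinear F p r)))
          ≡⟨ ∑ᵖ-cong entry ⟩
        ∑ᵖ (λ p → ((tβ p - y * β p) + y * (ω₁β p + ω₂β p)) - f p * δ p r)
          ≡⟨ sum-- (points F) (λ p → (tβ p - y * β p) + y * (ω₁β p + ω₂β p)) (λ p → f p * δ p r) ⟩
        ∑ᵖ (λ p → (tβ p - y * β p) + y * (ω₁β p + ω₂β p)) - ∑ᵖ (λ p → f p * δ p r)
          ≡⟨ cong₂ _-_ expand (∑ᵖ-δ f r ptr) ⟩
        ((∑ᵖ tβ - y * ∑ᵖ β) + y * (∑ᵖ ω₁β + ∑ᵖ ω₂β)) - f r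
          ≡⟨ cong₂ _-_ (cong₂ _+_
               (cong₂ (λ g b → g - y * b) (sum-cong (points F) (λ p → cong (λ z → 𝟙 (T p) * zero? z) (B-sym p r)))
                  (points-perp P₁ r (point-nonzero {r} ptr) (point-singular {r} ptr)))
               (cong (y *_) (cong₂ _+_ (plane-points-perp P₁ r r∉₁) (plane-points-perp P₂ r r∉₂)))) f-r ⟩
        ((perp-weight r - y * (q̂ * (q̂ + 1ℚ) * (q̂ + 1ℚ) + 1ℚ)) + y * ((q̂ + 1ℚ) + (q̂ + 1ℚ))) - (𝟙 (T r) - y)
          -- The coefficient of y is -(q(q + 1)² + 1) + 2(q + 1) + 1 = -(q² - 1)(q + 2). It splits
          -- into q² - 1 for the eigenvalue term and (q² - 1)(q + 1) for x(q + 1).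
          ≡⟨ solve 4 (λ q g y t →
               ((g :- y :* (q :* (q :+ con 1ℚ) :* (q :+ con 1ℚ) :+ con 1ℚ)) :+ y :* ((q :+ con 1ℚ) :+ (q :+ con 1ℚ))) :- (t :- y)
               := (q :* q :- con 1ℚ) :* (t :- y) :+ (g :- ((q :* q :- con 1ℚ) :* y :* (q :+ con 1ℚ) :+ q :* q :* t)))
               refl q̂ (perp-weight r) y (𝟙 (T r)) ⟩
        (q̂ * q̂ - 1ℚ) * (𝟙 (T r) - y) + (perp-weight r - ((q̂ * q̂ - 1ℚ) * y * (q̂ + 1ℚ) + q̂ * q̂ * 𝟙 (T r)))
          ≡⟨ cong₂ _+_ (cong₂ _*_ (sym q²-1) (cong (_- y) (sym (χ≡𝟙 F (T r)))))
               (cong₂ (λ a t → perp-weight r - (a * (q̂ + 1ℚ) + q̂ * q̂ * t)) (sym x≡)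
                 (sym (ext-normalised (𝟙 ∘ T) r (point-normalised {r} ptr)))) ⟩
        ℕ→ℚ (q ℕ.* q ℕ.∸ 1) * (χ F (T r) - y) + defect r ∎
        where
        β tβ ω₁β ω₂β f : Vec K 6 → ℚ
        β p = zero? (B p r)
        tβ p = 𝟙 (T p) * β p
        ω₁β p = P₁.ω p * β p
        ω₂β p = P₂.ω p * β p
        -- The entry of c' - y j' at `p`, extended by zero to π₁ ∪ π₂; disjointness of the planes
        -- makes 1 - ω₁ - ω₂ the indicator of the outside.
        f p = 𝟙 (T p) - y * ((1ℚ - P₁.ω p) - P₂.ω p)

        ∉ : ∀ P π → Spans P π → π r ≡ false → ¬ (∃ λ a → Plane.m P a ≡ r)
        ∉ P π s πr r∈ with trans (sym πr) (proj₂ (s r ptr) r∈)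
        ... | ()
        r∉₁ = ∉ P₁ π₁ s₁ π₁r
        r∉₂ = ∉ P₂ π₂ s₂ π₂r

        f-r : f r ≡ 𝟙 (T r) - y
        f-r = trans
          (cong₂ (λ a b → 𝟙 (T r) - y * ((1ℚ - a) - b)) (𝟙-no (P₁.span? r) r∉₁) (𝟙-no (P₂.span? r) r∉₂))
          (solve 2 (λ t y → t :- y :* ((con 1ℚ :- con 0ℚ) :- con 0ℚ) := t :- y) refl (𝟙 (T r)) y)

        expand : ∑ᵖ (λ p → (tβ p - y * β p) + y * (ω₁β p + ω₂β p)) ≡ (∑ᵖ tβ - y * ∑ᵖ β) + y * (∑ᵖ ω₁β + ∑ᵖ ω₂β)
        expand = trans (sum-+ (points F) (λ p → tβ p - y * β p) (λ p → y * (ω₁β p + ω₂β p))) (cong₂ _+_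
          (trans (sum-- (points F) tβ (λ p → y * β p)) (cong (λ z → ∑ᵖ tβ - z) (sum-* (points F) y β)))
          (trans (sum-* (points F) y (λ p → ω₁β p + ω₂β p)) (cong (y *_) (sum-+ (points F) ω₁β ω₂β))))

        outside-weight : ∀ p → IsPoint F p →
          𝟙 (not (π₁ p ∨ π₂ p)) * (𝟙 (T p) - y) ≡ f p
        outside-weight p pt = trans
          (cases (π₁ p) (π₂ p) (T p) (λ (h₁ , h₂) → dis p pt (h₁ , h₂)) (T-outside p pt))
          (cong₂ (λ a b → 𝟙 (T p) - y * ((1ℚ - a) - b)) (𝟙-π≡ω P₁ π₁ s₁ p pt) (𝟙-π≡ω P₂ π₂ s₂ p pt))
          where
          cases : ∀ b₁ b₂ t → ¬ (b₁ ≡ true × b₂ ≡ true) → (t ≡ true → b₁ ≡ false × b₂ ≡ false) →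
            𝟙 (not (b₁ ∨ b₂)) * (𝟙 t - y) ≡ 𝟙 t - y * ((1ℚ - 𝟙 b₁) - 𝟙 b₂)
          cases true  true  _     ¬both _ = ⊥-elim (¬both (refl , refl))
          cases true  false true  _ h with h refl
          ... | () , _
          cases false true  true  _ h with h refl
          ... | _ , ()
          cases true  false false _ _ = solve 1 (λ y → con 0ℚ :* (con 0ℚ :- y) := con 0ℚ :- y :* ((con 1ℚ :- con 1ℚ) :- con 0ℚ)) refl y
          cases false true  false _ _ = solve 1 (λ y → con 0ℚ :* (con 0ℚ :- y) := con 0ℚ :- y :* ((con 1ℚ :- con 0ℚ) :- con 1ℚ)) refl y
          cases false false t     _ _ = solve 2 (λ t y → con 1ℚ :* (t :- y) := t :- y :* ((con 1ℚ :- con 0ℚ) :- con 0ℚ)) refl (𝟙 t) y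

        entry : ∀ p → IsPoint F p →
          𝟙 (not (π₁ p ∨ π₂ p)) * ((χ F (T p) - y) * χ F (collinear F p r)) ≡
          ((tβ p - y * β p) + y * (ω₁β p + ω₂β p)) - f p * δ p r
        entry p pt = begin
          𝟙 (not (π₁ p ∨ π₂ p)) * ((χ F (T p) - y) * χ F (collinear F p r))
            ≡⟨ cong₂ (λ t c → 𝟙 (not (π₁ p ∨ π₂ p)) * ((t - y) * c)) (χ≡𝟙 F (T p))
                 (trans (χ≡𝟙 F (collinear F p r)) (𝟙-collinear p r (point-singular {p} pt) (point-singular {r} ptr))) ⟩
          𝟙 (not (π₁ p ∨ π₂ p)) * ((𝟙 (T p) - y) * (β p - δ p r))
            ≡⟨ sym (ℚₚ.*-assoc (𝟙 (not (π₁ p ∨ π₂ p))) (𝟙 (T p) - y) (β p - δ p r)) ⟩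
          𝟙 (not (π₁ p ∨ π₂ p)) * (𝟙 (T p) - y) * (β p - δ p r)
            ≡⟨ cong (_* (β p - δ p r)) (outside-weight p pt) ⟩
          f p * (β p - δ p r)
            ≡⟨ solve 6 (λ t y a b β d → (t :- y :* ((con 1ℚ :- a) :- b)) :* (β :- d) :=
                 ((t :* β :- y :* β) :+ y :* (a :* β :+ b :* β)) :- (t :- y :* ((con 1ℚ :- a) :- b)) :* d)
                 refl (𝟙 (T p)) y (P₁.ω p) (P₂.ω p) (β p) (δ p r) ⟩
          ((tβ p - y * β p) + y * (ω₁β p + ω₂β p)) - f p * δ p r ∎

      tight⇒matrix : IsTight F T x → MatrixEq F π₁ π₂ T x
      tight⇒matrix tight r ptr π₁r π₂r = trans (column-sum≡ r ptr π₁r π₂r)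
        (trans (cong (ℕ→ℚ (q ℕ.* q ℕ.∸ 1) * (χ F (T r) - y) +_) (tight⇒defect≡0 r ptr (tight r ptr)))
               (ℚₚ.+-identityʳ (ℕ→ℚ (q ℕ.* q ℕ.∸ 1) * (χ F (T r) - y))))

      module _ (matrix : MatrixEq F π₁ π₂ T x) where

        defect-outside : ∀ r → IsPoint F r → π₁ r ≡ false → π₂ r ≡ false → defect r ≡ 0ℚ
        defect-outside r ptr π₁r π₂r = begin
          defect r                ≡⟨ solve 2 (λ a d → d := (a :+ d) :- a) refl rhs (defect r) ⟩
          (rhs + defect r) - rhs  ≡⟨ cong (_- rhs) (trans (sym (column-sum≡ r ptr π₁r π₂r)) (matrix r ptr π₁r π₂r)) ⟩
          rhs - rhs               ≡⟨ ℚₚ.+-inverseʳ rhs ⟩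
          0ℚ                      ∎
          where
          rhs : ℚ
          rhs = ℕ→ℚ (q ℕ.* q ℕ.∸ 1) * (χ F (T r) - y)

        -- Homogeneity moves the question to the normalised multiple of `v`, which is a point off
        -- both generators.
        defect-outside-vector : ∀ v → v ≢ 𝟎 → Q v ≡ 0ᶠ →
          ¬ (∃ λ a → P₁.m a ≡ v) → ¬ (∃ λ a → P₂.m a ≡ v) → defect v ≡ 0ℚ
        defect-outside-vector v v≢0 Qv≡0 v∉₁ v∉₂ with normaliser v v≢0
        ... | c , Nc , _ = trans (sym (defect-homogeneous v c≢0)) (defect-outside (c • v) pt (off P₁ π₁ s₁ v∉₁) (off P₂ π₂ s₂ v∉₂))
          where
          c≢0 : c ≢ 0ᶠ
          c≢0 = normaliser-nonzero {v = v} Nc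
          pt : IsPoint F (c • v)
          pt = point-intro {c • v} Nc (singular-• c v Qv≡0)
          off : ∀ P π → Spans P π → ¬ (∃ λ a → Plane.m P a ≡ v) → π (c • v) ≡ false
          off P π s v∉ = ¬-not (λ π≡true → v∉ (span-•⁻ P c≢0 (proj₁ (s (c • v) pt) π≡true)))

        matrix⇒defect≡0 : ∀ p → IsPoint F p → defect p ≡ 0ℚ
        matrix⇒defect≡0 p pt with π₁ p in π₁p | π₂ p in π₂p
        ... | false | false = defect-outside p pt π₁p π₂p
        ... | true  | _     with proj₁ (s₁ p pt) π₁p
        -- The common value of the plane sums is left to unification with `∑-defect`.
        ...   | a , refl = zero-on-plane P₁ P₂ (disjoint-spans P₁ P₂ s₁ s₂ dis) defect defect-homogeneous _ ∑-defect
                             defect-outside-vector a (λ { refl → point-nonzero {p} pt P₁.m-𝟎 })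
        matrix⇒defect≡0 p pt | false | true with proj₁ (s₂ p pt) π₂p
        -- The roles are exchanged: the graphs are now taken over `P₂` and miss `P₁`.
        ...   | a , refl = zero-on-plane P₂ P₁ (λ v∈₂ v∈₁ → disjoint-spans P₁ P₂ s₁ s₂ dis v∈₁ v∈₂) defect defect-homogeneous _ ∑-defect
                             (λ v v≢0 Qv≡0 v∉₂ v∉₁ → defect-outside-vector v v≢0 Qv≡0 v∉₁ v∉₂) a (λ { refl → point-nonzero {p} pt P₂.m-𝟎 })

        matrix⇒tight : IsTight F T x
        matrix⇒tight p pt = defect≡0⇒tight p pt (matrix⇒defect≡0 p pt)

mainTheorem5 : (q : ℕ) (F : FiniteField q)
    (π₁ π₂ : PointSet F) → IsGenerator F π₁ → IsGenerator F π₂ → DisjointSets F π₁ π₂ →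
    (T : PointSet F) →
    (∀ p → IsPoint F p → T p ≡ true → (π₁ p ≡ false × π₂ p ≡ false)) →
    (x : ℚ) →
    IsTight F T x ⇔ MatrixEq F π₁ π₂ T x
mainTheorem5 q F π₁ π₂ g₁ g₂ dis T T-outside x =
  let (P₁ , s₁) = generator⇒plane π₁ g₁
      (P₂ , s₂) = generator⇒plane π₂ g₂
  in mk⇔ (tight⇒matrix T x π₁ π₂ P₁ P₂ s₁ s₂ dis T-outside)
         (matrix⇒tight T x π₁ π₂ P₁ P₂ s₁ s₂ dis T-outside)
  where open HyperbolicQuadric F
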